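{- We have $$g(n,K_3,P_5)=\frac{n}{4}-o(n).$$
   Context: $P_5$ denotes the path on $5$ vertices and $K_3$ the triangle. For fixed graphs $H$ and $F$, the Constructor–Blocker game is played on the edge set of $K_n$: Constructor and Blocker alternately claim previously unclaimed edges, Constructor moving first. Constructor may only claim an edge if after claiming it his graph (all edges he has claimed) contains no copy of $F$ as a subgraph; Blocker may claim any unclaimed edge. The game ends when Constructor cannot claim a further edge or all edges are claimed. The score is the number of copies of $H$ (as subgraphs) all of whose edges were claimed by Constructor. Constructor maximizes, Blocker minimizes the score; $g(n,H,F)$ is the score under optimal play by both players. -}

module Defs where

open import Data.Nat using (ℕ; zero; suc; _+_; _*_; _<ᵇ_; _⊔_; _⊓_)
open import Data.Fin using (Fin; toℕ) renaming (_≟_ to _≟ᶠ_)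
open import Data.Bool using (Bool; true; false; _∧_; _∨_; not; if_then_else_)
open import Data.List using (List; []; _∷_; [_]; concatMap; map; filterᵇ; length; foldr; allFin)
open import Data.Product using (_×_; _,_)
open import Data.Bool.ListAction using (any)
open import Relation.Nullary.Decidable using (⌊_⌋)

-- Vertices of K_n are Fin n.  An edge {i,j} of K_n is stored as the
-- ordered pair (i , j) with toℕ i < toℕ j.
Edge : ℕ → Set
Edge n = Fin n × Fin n

allEdges : (n : ℕ) → List (Edge n)
allEdges n = concatMap (λ i → concatMap (λ j → if toℕ i <ᵇ toℕ j then [ (i , j) ] else []) (allFin n)) (allFin n)

module _ {n : ℕ} where

  _=ᶠ_ : Fin n → Fin n → Bool
  i =ᶠ j = ⌊ i ≟ᶠ j ⌋

  sameEdge : Edge n → Edge n → Bool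
  sameEdge (a , b) (c , d) = (a =ᶠ c) ∧ (b =ᶠ d)

  memE : Edge n → List (Edge n) → Bool
  memE e G = any (sameEdge e) G

  adj : List (Edge n) → Fin n → Fin n → Bool
  adj G u v = memE (u , v) G ∨ memE (v , u) G

  anyV : (Fin n → Bool) → Bool
  anyV p = any p (allFin n)

  neq : Fin n → Fin n → Bool
  neq i j = not (i =ᶠ j)

  hasP5 : List (Edge n) → Bool
  hasP5 G = anyV λ a → anyV λ b → anyV λ c → anyV λ d → anyV λ e →
    (neq a b ∧ neq a c ∧ neq a d ∧ neq a e ∧ neq b c ∧ neq b d ∧ neq b e
      ∧ neq c d ∧ neq c e ∧ neq d e)
    ∧ adj G a b ∧ adj G b c ∧ adj G c d ∧ adj G d e

  triangles : List (Edge n) → ℕ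
  triangles G = length (filterᵇ (λ t → t)
    (concatMap (λ i → concatMap (λ j → map (λ k →
      (toℕ i <ᵇ toℕ j) ∧ (toℕ j <ᵇ toℕ k) ∧ adj G i j ∧ adj G j k ∧ adj G i k)
      (allFin n)) (allFin n)) (allFin n)))

  unclaimed : List (Edge n) → List (Edge n) → List (Edge n)
  unclaimed C B = filterᵇ (λ e → not (memE e C ∨ memE e B)) (allEdges n)

  legalC : List (Edge n) → List (Edge n) → List (Edge n)
  legalC C B = filterᵇ (λ e → not (hasP5 (e ∷ C))) (unclaimed C B)

maxOr : ℕ → List ℕ → ℕ
maxOr d [] = d
maxOr d (x ∷ xs) = foldr _⊔_ x xs

minOr : ℕ → List ℕ → ℕ
minOr d [] = d
minOr d (x ∷ xs) = foldr _⊓_ x xs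

-- Minimax value of the Constructor–Blocker game (H = K_3, F = P_5) from a
-- position with Constructor's edges C and Blocker's edges B.
-- valC: Constructor to move; valB: Blocker to move.  The fuel argument
-- bounds the number of remaining moves (each move claims a new edge).
-- If the player to move has no move, the game has ended and the score is
-- the number of triangles in Constructor's graph.
mutual
  valC : {n : ℕ} → ℕ → List (Edge n) → List (Edge n) → ℕ
  valC zero C B = triangles C
  valC (suc f) C B = maxOr (triangles C) (map (λ e → valB f (e ∷ C) B) (legalC C B))

  valB : {n : ℕ} → ℕ → List (Edge n) → List (Edge n) → ℕ
  valB zero C B = triangles C
  valB (suc f) C B = minOr (triangles C) (map (λ e → valC f C (e ∷ B)) (unclaimed C B))

-- g(n, K_3, P_5): Constructor moves first on the empty board; the number of
-- edges of K_n is enough fuel for the whole game.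
g : ℕ → ℕ
g n = valC {n} (length (allEdges n)) [] []

{-# OPTIONS --safe #-}

-- Upper bound.  Blocker answers so that every union S of components of Constructor's graph C with
-- |S| = 3 or 4 satisfies c(S) + 2 ≤ b(S) + |S|, where c and b count the edges of the two players
-- inside S.  A move of Constructor violates this for at most one S, and then S contains a free edge,
-- which Blocker claims.  So C has neither a component K₃ nor a component on four vertices with five
-- edges.  As C has no P₅, each triangle has a neighbour outside, and the resulting 4-sets
-- are pairwise disjoint: there are at most n/4 triangles.
--
-- Lower bound.  Constructor builds a triangle with a pendant edge on four fresh vertices: a star with
-- centre y and leaves x, z, w, where w is chosen last so that xw, zw are free.  Blocker can
-- take only one of these two edges and the other one closes a triangle.  The vertices are chosen with
-- low degree in Blocker's graph, which is possible as long as a linear number of vertices is fresh.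

module Submission where

open import Defs
open import Data.Bool using (Bool; true; false; not; _∧_; _∨_; T; if_then_else_)
open import Data.Bool.Properties using (T?; T-∧; T-∨; T-≡)
open import Data.Empty using (⊥; ⊥-elim)
open import Data.Fin using (Fin; toℕ) renaming (_≟_ to _≟ᶠ_)
open import Data.Fin.Properties using (any?; toℕ-injective)
open import Data.List using (List; []; _∷_; [_]; _++_; map; concat; concatMap; filter; filterᵇ; length; foldr; allFin; cartesianProduct)
open import Data.List.Properties using (map-∘; map-++; filter-all; length-++; length-tabulate; length-filter; map-cong)
open import Data.Nat.ListAction using (sum)
open import Data.List.Membership.Propositional using (_∈_; _∉_; find; lose)
open import Data.List.Membership.Propositional.Properties using (∈-filter⁺; ∈-filter⁻; ∈-allFin; ∈-concatMap⁺; ∈-concatMap⁻; ∈-map⁻; ∈-map⁺; ∈-++⁺ˡ; ∈-++⁺ʳ; ∈-++⁻; ∈-∃++; ∈-cartesianProduct⁺; ∈-length)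
open import Data.List.Relation.Binary.Disjoint.Propositional using (Disjoint)
open import Data.List.Relation.Binary.Subset.Propositional using (_⊆_)
open import Data.List.Relation.Binary.Subset.Propositional.Properties using () renaming (map⁺ to ⊆-map)
open import Data.List.Relation.Unary.All using (All; []; _∷_)
import Data.List.Relation.Unary.All as All
import Data.List.Relation.Unary.All.Properties as All
open import Data.List.Relation.Unary.AllPairs using (AllPairs; []; _∷_)
open import Data.List.Relation.Unary.Any using (Any; here; there)
import Data.List.Relation.Unary.Any as Any
open import Data.List.Relation.Unary.Any.Properties using (any⁺; any⁻)
open import Data.List.Relation.Unary.Unique.Propositional using (Unique)
import Data.List.Relation.Unary.Unique.Propositional.Properties as Unique
open import Data.Nat using (ℕ; zero; suc; _+_; _*_; _∸_; _≤_; _<_; _<ᵇ_; _⊔_; _⊓_; z≤n; s≤s; _≤?_; _/_; _%_)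
open import Data.Nat.Properties
open import Data.Nat.DivMod using (m/n*n≤m; m≡m%n+[m/n]*n; m%n<n)
open import Data.Nat.Tactic.RingSolver using (solve-∀)
open import Data.Product using (Σ; ∃; ∃₂; _×_; _,_; proj₁; proj₂)
open import Data.Sum using (_⊎_; inj₁; inj₂; [_,_]′)
import Data.Sum as Sum
open import Data.Unit using (tt)
open import Function using (_∘_; id; case_of_)
open import Function.Bundles using (Equivalence)
open import Relation.Binary.Definitions using (tri<; tri≈; tri>)
open import Relation.Binary.PropositionalEquality using (_≡_; _≢_; refl; sym; trans; cong; cong₂; subst; subst₂; ≢-sym)
open import Relation.Nullary using (¬_; Dec; yes; no; contradiction; ¬?)
open import Relation.Nullary.Decidable using (toWitness; fromWitness; decidable-stable; _×-dec_)

-- The inequality is imposed on all unions of components, not on components alone, because it has to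
-- survive merging: a union of components of the graph after Constructor's move is already one of
-- the graph before it. So the old inequality applies to it, only the new edge has to be accounted
-- for, and the deficit is at most one, which is what a single reply can repair. Connectivity is
-- never defined; closure under adjacency is enough. This direction has no error term: `4 * g n ≤ n`
-- for every n. The o(n) comes from Constructor. Four moves per block mean at most 4t ≤ n replies,
-- so by the handshake inequality only about 2n/K vertices reach Blocker degree K, and each choice
-- also avoids O(K) vertices near the current block. K is fixed before n grows, so the loss is
-- O(n/K) + O(K).

-- Lists and counting

module _ {A : Set} where

  ∈⇒suc-length : {x : A} {ys : List A} (as bs : List A) → ys ≡ as ++ x ∷ bs → length ys ≡ suc (length (as ++ bs))
  ∈⇒suc-length as bs refl = trans (length-++ as)
    (trans (+-suc (length as) (length bs)) (cong suc (sym (length-++ as))))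

  Unique∧⊆⇒length≤ : {xs ys : List A} → Unique xs → xs ⊆ ys → length xs ≤ length ys
  Unique∧⊆⇒length≤ {[]} _ _ = z≤n
  Unique∧⊆⇒length≤ {x ∷ xs} {ys} (x∉ ∷ u) sub with ∈-∃++ (sub (here refl))
  ... | as , bs , eq = subst (suc (length xs) ≤_) (sym (∈⇒suc-length as bs eq))
      (s≤s (Unique∧⊆⇒length≤ u sub′))
    where
    sub′ : xs ⊆ as ++ bs
    sub′ {y} y∈ with ∈-++⁻ as (subst (y ∈_) eq (sub (there y∈)))
    ... | inj₁ y∈as = ∈-++⁺ˡ y∈as
    ... | inj₂ (here y≡x) = contradiction (sym y≡x) (All.lookup x∉ y∈)
    ... | inj₂ (there y∈bs) = ∈-++⁺ʳ as y∈bs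

  count : (A → Bool) → List A → ℕ
  count p xs = length (filterᵇ p xs)

  module _ {p q : A → Bool} where

    count-mono : ∀ xs → (∀ {x} → x ∈ xs → T (p x) → T (q x)) → count p xs ≤ count q xs
    count-mono [] _ = z≤n
    count-mono (x ∷ xs) imp with p x in px | q x in qx
    ... | true  | true  = s≤s (count-mono xs (imp ∘ there))
    ... | true  | false = ⊥-elim (subst T qx (imp (here refl) (subst T (sym px) tt)))
    ... | false | true  = m≤n⇒m≤1+n (count-mono xs (imp ∘ there))
    ... | false | false = count-mono xs (imp ∘ there)

    count-strict : ∀ {x} xs → (∀ {x} → x ∈ xs → T (p x) → T (q x)) →
      x ∈ xs → ¬ T (p x) → T (q x) → count p xs < count q xs
    count-strict (x ∷ xs) imp (here refl) ¬px qx with p x | q x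
    ... | true  | _    = ⊥-elim (¬px tt)
    ... | false | true = s≤s (count-mono xs (imp ∘ there))
    count-strict (y ∷ xs) imp (there x∈) ¬px qx with p y in py | q y in qy
    ... | true  | true  = s≤s (count-strict xs (imp ∘ there) x∈ ¬px qx)
    ... | true  | false = ⊥-elim (subst T qy (imp (here refl) (subst T (sym py) tt)))
    ... | false | true  = m≤n⇒m≤1+n (count-strict xs (imp ∘ there) x∈ ¬px qx)
    ... | false | false = count-strict xs (imp ∘ there) x∈ ¬px qx

    count-suc : ∀ {v} {xs} → Unique xs → (∀ {x} → x ∈ xs → T (p x) → T (q x) ⊎ x ≡ v) →
      count p xs ≤ suc (count q xs)
    count-suc {xs = []} _ _ = z≤n
    count-suc {v} {x ∷ xs} (x∉ ∷ u) imp with p x in px | q x in qx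
    ... | true  | true  = s≤s (count-suc u (imp ∘ there))
    ... | false | true  = m≤n⇒m≤1+n (count-suc u (imp ∘ there))
    ... | false | false = count-suc u (imp ∘ there)
    ... | true  | false with imp (here refl) (subst T (sym px) tt)
    ...   | inj₁ t    = ⊥-elim (subst T qx t)
    ...   | inj₂ refl = s≤s (count-mono xs λ x∈ t →
              [ id , (λ x≡v → contradiction (sym x≡v) (All.lookup x∉ x∈)) ]′ (imp (there x∈) t))

    count-disjoint : ∀ xs → (∀ {x} → x ∈ xs → T (p x) → T (q x) → ⊥) →
      count p xs + count q xs ≤ length xs
    count-disjoint [] _ = z≤n
    count-disjoint (x ∷ xs) dis with p x in px | q x in qx
    ... | true  | true  = ⊥-elim (dis (here refl) (subst T (sym px) tt) (subst T (sym qx) tt))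
    ... | true  | false = s≤s (count-disjoint xs (dis ∘ there))
    ... | false | true  = ≤-trans (≤-reflexive (+-suc _ _)) (s≤s (count-disjoint xs (dis ∘ there)))
    ... | false | false = m≤n⇒m≤1+n (count-disjoint xs (dis ∘ there))

    count-cover : ∀ xs → (∃ λ x → x ∈ xs × ¬ T (p x) × ¬ T (q x)) ⊎ length xs ≤ count p xs + count q xs
    count-cover [] = inj₂ z≤n
    count-cover (x ∷ xs) with p x in px | q x in qx | count-cover xs
    ... | _     | _     | inj₁ (y , y∈ , ny) = inj₁ (y , there y∈ , ny)
    ... | false | false | inj₂ _ = inj₁ (x , here refl , subst T px , subst T qx)
    ... | true  | true  | inj₂ le = inj₂ (s≤s (≤-trans le (+-monoʳ-≤ (count p xs) (n≤1+n _))))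
    ... | true  | false | inj₂ le = inj₂ (s≤s le)
    ... | false | true  | inj₂ le = inj₂ (≤-trans (s≤s le) (≤-reflexive (sym (+-suc _ _))))

  count-none : {p : A → Bool} (xs : List A) → (∀ {x} → x ∈ xs → ¬ T (p x)) → count p xs ≡ 0
  count-none [] _ = refl
  count-none {p} (x ∷ xs) non with p x in px
  ... | true  = ⊥-elim (non (here refl) (subst T (sym px) tt))
  ... | false = count-none xs (non ∘ there)

length-allFin : ∀ n → length (allFin n) ≡ n
length-allFin n = length-tabulate {n = n} id

module _ {n : ℕ} where

  open import Data.List.Membership.DecPropositional (_≟ᶠ_ {n}) using (_∈?_; _∉?_) public

  Unique⇒length≤ : {xs : List (Fin n)} → Unique xs → length xs ≤ n
  Unique⇒length≤ {xs} u = subst (length xs ≤_) (length-allFin n) (Unique∧⊆⇒length≤ u (λ {x} _ → ∈-allFin x))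

  length<⇒∃∉ : (xs : List (Fin n)) → length xs < n → ∃ λ v → v ∉ xs
  length<⇒∃∉ xs lt with any? (_∉? xs)
  ... | yes ∃∉ = ∃∉
  ... | no ¬∃∉ = contradiction
    (subst (_≤ length xs) (length-allFin n)
      (Unique∧⊆⇒length≤ (Unique.allFin⁺ n) (λ {v} _ → decidable-stable (v ∈? xs) (λ v∉ → ¬∃∉ (v , v∉)))))
    (<⇒≱ lt)

-- Graphs as lists of edges

T-∧⁺ : ∀ {x y} → T x → T y → T (x ∧ y)
T-∧⁺ p q = Equivalence.from T-∧ (p , q)

T-∧⁻ : ∀ {x y} → T (x ∧ y) → T x × T y
T-∧⁻ = Equivalence.to T-∧

T-not⁺ : ∀ {x} → ¬ T x → T (not x)
T-not⁺ {true}  ¬t = ⊥-elim (¬t tt)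
T-not⁺ {false} _  = tt

T-not⁻ : ∀ {x} → T (not x) → ¬ T x
T-not⁻ {false} _ ()

module _ {n : ℕ} where

  private
    Graph : Set
    Graph = List (Edge n)

  Adj : Graph → Fin n → Fin n → Set
  Adj G u v = (u , v) ∈ G ⊎ (v , u) ∈ G

  Adj-sym : ∀ {G u v} → Adj G u v → Adj G v u
  Adj-sym = Sum.swap

  Adj-∷ : ∀ {G e u v} → Adj G u v → Adj (e ∷ G) u v
  Adj-∷ = Sum.map there there

  sameEdge⇒≡ : ∀ {e f : Edge n} → T (sameEdge e f) → e ≡ f
  sameEdge⇒≡ {a , b} {c , d} t with a ≟ᶠ c | b ≟ᶠ d
  ... | yes refl | yes refl = refl

  sameEdge-refl : (e : Edge n) → T (sameEdge e e)
  sameEdge-refl (a , b) with a ≟ᶠ a | b ≟ᶠ b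
  ... | yes _  | yes _  = tt
  ... | yes _  | no b≢b = b≢b refl
  ... | no a≢a | _      = a≢a refl

  memE⁻ : ∀ {e : Edge n} {G} → T (memE e G) → e ∈ G
  memE⁻ {e} {G} t with find (any⁻ (sameEdge e) G t)
  ... | f , f∈ , same = subst (_∈ G) (sym (sameEdge⇒≡ same)) f∈

  memE⁺ : ∀ {e : Edge n} {G} → e ∈ G → T (memE e G)
  memE⁺ {e} e∈ = any⁺ (sameEdge e) (lose e∈ (sameEdge-refl e))

  adj⁻ : ∀ {G u v} → T (adj G u v) → Adj G u v
  adj⁻ {G} t = Sum.map memE⁻ memE⁻ (Equivalence.to T-∨ t)

  adj⁺ : ∀ {G u v} → Adj G u v → T (adj G u v)
  adj⁺ uv = Equivalence.from T-∨ (Sum.map memE⁺ memE⁺ uv)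

  Adj? : ∀ G u v → Dec (Adj G u v)
  Adj? G u v with adj G u v in eq
  ... | true  = yes (adj⁻ (subst T (sym eq) tt))
  ... | false = no λ uv → subst T eq (adj⁺ uv)

  Ordered : Graph → Set
  Ordered G = ∀ {u v} → (u , v) ∈ G → toℕ u < toℕ v

  Ordered⇒≢ : ∀ {G u v} → Ordered G → Adj G u v → u ≢ v
  Ordered⇒≢ ord (inj₁ uv) refl = <-irrefl refl (ord uv)
  Ordered⇒≢ ord (inj₂ vu) refl = <-irrefl refl (ord vu)

  Ordered-∷ : ∀ {G e} → toℕ (proj₁ e) < toℕ (proj₂ e) → Ordered G → Ordered (e ∷ G)
  Ordered-∷ lt ord (here refl) = lt
  Ordered-∷ lt ord (there uv)  = ord uv

  private
    cell : Fin n → Fin n → List (Edge n)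
    cell i j = if toℕ i <ᵇ toℕ j then [ (i , j) ] else []

    row : Fin n → List (Edge n)
    row i = concatMap (cell i) (allFin n)

  ∈-allEdges⁻ : ∀ {u v} → (u , v) ∈ allEdges n → toℕ u < toℕ v
  ∈-allEdges⁻ uv with find (∈-concatMap⁻ row {xs = allFin n} uv)
  ... | i , _ , uv∈i with find (∈-concatMap⁻ (cell i) {xs = allFin n} uv∈i)
  ... | j , _ , uv∈ij with toℕ i <ᵇ toℕ j in lt
  ∈-allEdges⁻ uv | i , _ , _ | j , _ , here refl | true = <ᵇ⇒< (toℕ i) (toℕ j) (subst T (sym lt) tt)

  ∈-allEdges⁺ : ∀ {u v} → toℕ u < toℕ v → (u , v) ∈ allEdges n
  ∈-allEdges⁺ {u} {v} lt = ∈-concatMap⁺ row (lose (∈-allFin u) (∈-concatMap⁺ (cell u) (lose (∈-allFin v)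
    (subst (λ b → (u , v) ∈ (if b then [ (u , v) ] else []))
      (sym (Equivalence.to T-≡ (<⇒<ᵇ lt))) (here refl)))))

  edge : Fin n → Fin n → Edge n
  edge u v = if toℕ u <ᵇ toℕ v then (u , v) else (v , u)

  edge-cases : ∀ u v → edge u v ≡ (u , v) ⊎ edge u v ≡ (v , u)
  edge-cases u v with toℕ u <ᵇ toℕ v
  ... | true  = inj₁ refl
  ... | false = inj₂ refl

  edge∈allEdges : ∀ {u v} → u ≢ v → edge u v ∈ allEdges n
  edge∈allEdges {u} {v} u≢v with toℕ u <ᵇ toℕ v in eq
  ... | true  = ∈-allEdges⁺ (<ᵇ⇒< (toℕ u) (toℕ v) (subst T (sym eq) tt))
  ... | false = ∈-allEdges⁺ (≤∧≢⇒< (≮⇒≥ (λ lt → subst T eq (<⇒<ᵇ lt))) (u≢v ∘ sym ∘ toℕ-injective))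

  edge-Adj : ∀ {G} u v → Adj (edge u v ∷ G) u v
  edge-Adj u v with edge-cases u v
  ... | inj₁ eq = inj₁ (here (sym eq))
  ... | inj₂ eq = inj₂ (here (sym eq))

  Adj-∷⁻ : ∀ {G a b u v} → Adj ((a , b) ∷ G) u v → Adj G u v ⊎ ((u ≡ a × v ≡ b) ⊎ (u ≡ b × v ≡ a))
  Adj-∷⁻ (inj₁ (here refl)) = inj₂ (inj₁ (refl , refl))
  Adj-∷⁻ (inj₂ (here refl)) = inj₂ (inj₂ (refl , refl))
  Adj-∷⁻ (inj₁ (there p)) = inj₁ (inj₁ p)
  Adj-∷⁻ (inj₂ (there p)) = inj₁ (inj₂ p)

  Adj-edge⁻ : ∀ {G a b u v} → Adj (edge a b ∷ G) u v → Adj G u v ⊎ ((u ≡ a × v ≡ b) ⊎ (u ≡ b × v ≡ a))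
  Adj-edge⁻ {a = a} {b} uv with edge-cases a b
  ... | inj₁ eq rewrite eq = Adj-∷⁻ uv
  ... | inj₂ eq rewrite eq = Sum.map₂ Sum.swap (Adj-∷⁻ uv)

  record Free (C B : Graph) (u v : Fin n) : Set where
    constructor mkFree
    field
      ≢-ends : u ≢ v
      ∉C     : ¬ Adj C u v
      ∉B     : ¬ Adj B u v
  open Free public

  claimed⁺ : ∀ {C B} {e : Edge n} → e ∈ C ⊎ e ∈ B → T (memE e C ∨ memE e B)
  claimed⁺ {C} {B} {e} = Equivalence.from (T-∨ {memE e C}) ∘ Sum.map memE⁺ memE⁺

  claimed⁻ : ∀ {C B} {e : Edge n} → T (memE e C ∨ memE e B) → e ∈ C ⊎ e ∈ B
  claimed⁻ {C} {B} {e} = Sum.map memE⁻ memE⁻ ∘ Equivalence.to (T-∨ {memE e C})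

  ∈-unclaimed⁻ : ∀ {C B e} → e ∈ unclaimed C B → e ∈ allEdges n × ¬ (e ∈ C) × ¬ (e ∈ B)
  ∈-unclaimed⁻ {C} {B} e∈ with ∈-filter⁻ (T? ∘ λ e → not (memE e C ∨ memE e B)) {xs = allEdges n} e∈
  ... | e∈all , t = e∈all , T-not⁻ t ∘ claimed⁺ {C} {B} ∘ inj₁ , T-not⁻ t ∘ claimed⁺ {C} {B} ∘ inj₂

  ∈-unclaimed⁺ : ∀ {C B e} → e ∈ allEdges n → ¬ (e ∈ C) → ¬ (e ∈ B) → e ∈ unclaimed C B
  ∈-unclaimed⁺ {C} {B} e∈ e∉C e∉B = ∈-filter⁺ (T? ∘ λ e → not (memE e C ∨ memE e B)) e∈
    (T-not⁺ ([ e∉C , e∉B ]′ ∘ claimed⁻ {C} {B}))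

  Free⇒unclaimed : ∀ {C B u v} → Free C B u v → edge u v ∈ unclaimed C B
  Free⇒unclaimed {C} {B} {u} {v} free =
    ∈-unclaimed⁺ (edge∈allEdges (≢-ends free)) (¬edge∈ (∉C free)) (¬edge∈ (∉B free))
    where
    ¬edge∈ : ∀ {G} → ¬ Adj G u v → ¬ (edge u v ∈ G)
    ¬edge∈ ¬uv e∈ with edge-cases u v
    ... | inj₁ eq = ¬uv (inj₁ (subst (_∈ _) eq e∈))
    ... | inj₂ eq = ¬uv (inj₂ (subst (_∈ _) eq e∈))

  unclaimed⇒Free : ∀ {C B u v} → Ordered C → Ordered B → (u , v) ∈ unclaimed C B → Free C B u v
  unclaimed⇒Free ordC ordB e∈ with ∈-unclaimed⁻ e∈
  ... | e∈all , e∉C , e∉B = mkFree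
    (λ { refl → <-irrefl refl (∈-allEdges⁻ e∈all) })
    [ e∉C , (λ vu → <-asym (∈-allEdges⁻ e∈all) (ordC vu)) ]′
    [ e∉B , (λ vu → <-asym (∈-allEdges⁻ e∈all) (ordB vu)) ]′

  -- The measure compared with the fuel: every move lowers it, so fuel that covers the unclaimed
  -- edges once covers them throughout the game.
  unclaimed-shrinks : ∀ C B C′ B′ {e} → e ∈ unclaimed C B → C ⊆ C′ → B ⊆ B′ → e ∈ C′ ⊎ e ∈ B′ →
    length (unclaimed C′ B′) < length (unclaimed C B)
  unclaimed-shrinks C B C′ B′ {e} e∈ C⊆ B⊆ claimed with ∈-unclaimed⁻ e∈
  ... | e∈all , e∉C , e∉B = count-strict (allEdges n)
      (λ {x} _ t → T-not⁺ (T-not⁻ t ∘ claimed⁺ {C′} {B′} {x} ∘ Sum.map C⊆ B⊆ ∘ claimed⁻ {C} {B} {x}))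
      e∈all (λ t → T-not⁻ t (claimed⁺ {C′} {B′} claimed)) (T-not⁺ ([ e∉C , e∉B ]′ ∘ claimed⁻ {C} {B}))

  Closed : Graph → List (Fin n) → Set
  Closed G S = ∀ {x y} → Adj G x y → x ∈ S → y ∈ S

  record Path₅ (G : Graph) : Set where
    constructor path
    field
      {a b c d e} : Fin n
      distinct : Unique (a ∷ b ∷ c ∷ d ∷ e ∷ [])
      ab : Adj G a b
      bc : Adj G b c
      cd : Adj G c d
      de : Adj G d e

  neq⁺ : ∀ {i j : Fin n} → i ≢ j → T (neq i j)
  neq⁺ i≢j = T-not⁺ (i≢j ∘ toWitness)

  neq⁻ : ∀ {i j : Fin n} → T (neq i j) → i ≢ j
  neq⁻ t i≡j = T-not⁻ t (fromWitness i≡j)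

  anyV⁺ : ∀ {p : Fin n → Bool} v → T (p v) → T (anyV p)
  anyV⁺ {p} v t = any⁺ p (lose (∈-allFin v) t)

  anyV⁻ : ∀ {p : Fin n → Bool} → T (anyV p) → ∃ λ v → T (p v)
  anyV⁻ {p} t with find (any⁻ p (allFin n) t)
  ... | v , _ , tv = v , tv

  hasP5⁺ : ∀ {G} → Path₅ G → T (hasP5 G)
  hasP5⁺ (path {a} {b} {c} {d} {e}
      ((a≢b ∷ a≢c ∷ a≢d ∷ a≢e ∷ []) ∷ (b≢c ∷ b≢d ∷ b≢e ∷ []) ∷ (c≢d ∷ c≢e ∷ []) ∷ (d≢e ∷ []) ∷ [] ∷ [])
      ab bc cd de) =
    anyV⁺ a (anyV⁺ b (anyV⁺ c (anyV⁺ d (anyV⁺ e (T-∧⁺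
      (T-∧⁺ (neq⁺ a≢b) (T-∧⁺ (neq⁺ a≢c) (T-∧⁺ (neq⁺ a≢d) (T-∧⁺ (neq⁺ a≢e)
        (T-∧⁺ (neq⁺ b≢c) (T-∧⁺ (neq⁺ b≢d) (T-∧⁺ (neq⁺ b≢e)
          (T-∧⁺ (neq⁺ c≢d) (T-∧⁺ (neq⁺ c≢e) (neq⁺ d≢e))))))))))
      (T-∧⁺ (adj⁺ ab) (T-∧⁺ (adj⁺ bc) (T-∧⁺ (adj⁺ cd) (adj⁺ de)))))))))

  hasP5⁻ : ∀ {G} → T (hasP5 G) → Path₅ G
  hasP5⁻ {G} t with anyV⁻ t
  ... | a , t with anyV⁻ t
  ... | b , t with anyV⁻ t
  ... | c , t with anyV⁻ t
  ... | d , t with anyV⁻ t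
  ... | e , t with T-∧⁻ t
  ... | ne , adjs with T-∧⁻ {adj G a b} adjs
  ... | ab , t with T-∧⁻ {adj G b c} t
  ... | bc , t with T-∧⁻ {adj G c d} t
  ... | cd , de with T-∧⁻ {neq a b} ne
  ... | a≢b , t with T-∧⁻ {neq a c} t
  ... | a≢c , t with T-∧⁻ {neq a d} t
  ... | a≢d , t with T-∧⁻ {neq a e} t
  ... | a≢e , t with T-∧⁻ {neq b c} t
  ... | b≢c , t with T-∧⁻ {neq b d} t
  ... | b≢d , t with T-∧⁻ {neq b e} t
  ... | b≢e , t with T-∧⁻ {neq c d} t
  ... | c≢d , t with T-∧⁻ {neq c e} t
  ... | c≢e , d≢e = path
      ((neq⁻ a≢b ∷ neq⁻ a≢c ∷ neq⁻ a≢d ∷ neq⁻ a≢e ∷ []) ∷ (neq⁻ b≢c ∷ neq⁻ b≢d ∷ neq⁻ b≢e ∷ [])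
        ∷ (neq⁻ c≢d ∷ neq⁻ c≢e ∷ []) ∷ (neq⁻ d≢e ∷ []) ∷ [] ∷ [])
      (adj⁻ ab) (adj⁻ bc) (adj⁻ cd) (adj⁻ de)

  ∈-legalC⁺ : ∀ {C B e} → e ∈ unclaimed C B → ¬ Path₅ (e ∷ C) → e ∈ legalC C B
  ∈-legalC⁺ {C} e∈ noP5 = ∈-filter⁺ (T? ∘ λ e → not (hasP5 (e ∷ C))) e∈ (T-not⁺ (noP5 ∘ hasP5⁻))

  ∈-legalC⁻ : ∀ {C B e} → e ∈ legalC C B → e ∈ unclaimed C B × ¬ Path₅ (e ∷ C)
  ∈-legalC⁻ {C} {B} e∈ with ∈-filter⁻ (T? ∘ λ e → not (hasP5 (e ∷ C))) {xs = unclaimed C B} e∈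
  ... | e∈un , t = e∈un , T-not⁻ t ∘ hasP5⁺

-- Triangles and the game value

⊔-foldr-≥ : ∀ {y} x xs → y ∈ x ∷ xs → y ≤ foldr _⊔_ x xs
⊔-foldr-≥ x [] (here refl) = ≤-refl
⊔-foldr-≥ x (z ∷ xs) (here refl) = m≤n⇒m≤o⊔n z (⊔-foldr-≥ x xs (here refl))
⊔-foldr-≥ x (z ∷ xs) (there (here refl)) = m≤m⊔n z _
⊔-foldr-≥ x (z ∷ xs) (there (there y∈)) = m≤n⇒m≤o⊔n z (⊔-foldr-≥ x xs (there y∈))

maxOr-≥ : ∀ {y} d xs → y ∈ xs → y ≤ maxOr d xs
maxOr-≥ d (x ∷ xs) = ⊔-foldr-≥ x xs

⊓-foldr-≤ : ∀ {y} x xs → y ∈ x ∷ xs → foldr _⊓_ x xs ≤ y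
⊓-foldr-≤ x [] (here refl) = ≤-refl
⊓-foldr-≤ x (z ∷ xs) (here refl) = m≤n⇒o⊓m≤n z (⊓-foldr-≤ x xs (here refl))
⊓-foldr-≤ x (z ∷ xs) (there (here refl)) = m⊓n≤m z _
⊓-foldr-≤ x (z ∷ xs) (there (there y∈)) = m≤n⇒o⊓m≤n z (⊓-foldr-≤ x xs (there y∈))

minOr-≤ : ∀ {y} d xs → y ∈ xs → minOr d xs ≤ y
minOr-≤ d (x ∷ xs) = ⊓-foldr-≤ x xs

module _ (P : ℕ → Set) where

  foldr-sel : {_∙_ : ℕ → ℕ → ℕ} → (∀ x y → x ∙ y ≡ x ⊎ x ∙ y ≡ y) →
    ∀ {x} xs → P x → (∀ {y} → y ∈ xs → P y) → P (foldr _∙_ x xs)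
  foldr-sel sel [] px pxs = px
  foldr-sel {_∙_} sel {x} (y ∷ xs) px pxs with sel y (foldr _∙_ x xs)
  ... | inj₁ eq = subst P (sym eq) (pxs (here refl))
  ... | inj₂ eq = subst P (sym eq) (foldr-sel sel xs px (pxs ∘ there))

  maxOr-elim : ∀ {d} xs → P d → (∀ {y} → y ∈ xs → P y) → P (maxOr d xs)
  maxOr-elim [] pd _ = pd
  maxOr-elim (x ∷ xs) _ pxs = foldr-sel ⊔-sel xs (pxs (here refl)) (pxs ∘ there)

  minOr-elim : ∀ {d} xs → P d → (∀ {y} → y ∈ xs → P y) → P (minOr d xs)
  minOr-elim [] pd _ = pd
  minOr-elim (x ∷ xs) _ pxs = foldr-sel ⊓-sel xs (pxs (here refl)) (pxs ∘ there)

  minOr-elim⁺ : ∀ {x} d xs → x ∈ xs → (∀ {y} → y ∈ xs → P y) → P (minOr d xs)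
  minOr-elim⁺ d (x ∷ xs) _ pxs = foldr-sel ⊓-sel xs (pxs (here refl)) (pxs ∘ there)

module _ {A : Set} where

  filterᵇ-map : {B : Set} (p : B → Bool) (f : A → B) (xs : List A) →
    length (filterᵇ p (map f xs)) ≡ count (p ∘ f) xs
  filterᵇ-map p f [] = refl
  filterᵇ-map p f (x ∷ xs) with p (f x)
  ... | true  = cong suc (filterᵇ-map p f xs)
  ... | false = filterᵇ-map p f xs

  concatMap-cartesianProduct : {B C : Set} (f : A × B → C) (xs : List A) (ys : List B) →
    concatMap (λ x → map (λ y → f (x , y)) ys) xs ≡ map f (cartesianProduct xs ys)
  concatMap-cartesianProduct f [] ys = refl
  concatMap-cartesianProduct f (x ∷ xs) ys = trans
    (cong₂ _++_ (map-∘ ys) (concatMap-cartesianProduct f xs ys))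
    (sym (map-++ f (map (x ,_) ys) (cartesianProduct xs ys)))

module _ {n : ℕ} where

  Triple : Set
  Triple = Fin n × Fin n × Fin n

  triples : List Triple
  triples = cartesianProduct (allFin n) (cartesianProduct (allFin n) (allFin n))

  triples-Unique : Unique triples
  triples-Unique = Unique.cartesianProduct⁺ (Unique.allFin⁺ n)
    (Unique.cartesianProduct⁺ (Unique.allFin⁺ n) (Unique.allFin⁺ n))

  isTriangle : List (Edge n) → Triple → Bool
  isTriangle G (i , j , k) = (toℕ i <ᵇ toℕ j) ∧ (toℕ j <ᵇ toℕ k) ∧ adj G i j ∧ adj G j k ∧ adj G i k

  -- A single predicate on one duplicate-free list of triples makes the counting lemmas applicable,
  -- and later yields a duplicate-free list of the triangles themselves.
  triangles≡count : ∀ G → triangles G ≡ count (isTriangle G) triples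
  triangles≡count G = trans
    (cong (length ∘ filterᵇ id) (trans
      (cong concat (map-cong (λ i → concatMap-cartesianProduct (λ (j , k) → isTriangle G (i , j , k)) (allFin n) (allFin n)) (allFin n)))
      (concatMap-cartesianProduct (isTriangle G) (allFin n) (cartesianProduct (allFin n) (allFin n)))))
    (filterᵇ-map id (isTriangle G) triples)

  Triangle : List (Edge n) → Fin n → Fin n → Fin n → Set
  Triangle G i j k = Adj G i j × Adj G j k × Adj G i k

  isTriangle⁻ : ∀ {G} i j k → T (isTriangle G (i , j , k)) → toℕ i < toℕ j × toℕ j < toℕ k × Triangle G i j k
  isTriangle⁻ {G} i j k t with T-∧⁻ {toℕ i <ᵇ toℕ j} t
  ... | i<j , t with T-∧⁻ {toℕ j <ᵇ toℕ k} t
  ... | j<k , t with T-∧⁻ {adj G i j} t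
  ... | ij , t with T-∧⁻ {adj G j k} t
  ... | jk , ik = <ᵇ⇒< (toℕ i) _ i<j , <ᵇ⇒< (toℕ j) _ j<k , adj⁻ ij , adj⁻ jk , adj⁻ ik

  isTriangle⁺ : ∀ {G i j k} → toℕ i < toℕ j → toℕ j < toℕ k → Triangle G i j k → T (isTriangle G (i , j , k))
  isTriangle⁺ i<j j<k (ij , jk , ik) =
    T-∧⁺ (<⇒<ᵇ i<j) (T-∧⁺ (<⇒<ᵇ j<k) (T-∧⁺ (adj⁺ ij) (T-∧⁺ (adj⁺ jk) (adj⁺ ik))))

  isTriangle-mono : ∀ {G e} t → T (isTriangle G t) → T (isTriangle (e ∷ G) t)
  isTriangle-mono {G} {e} (i , j , k) t with isTriangle⁻ {G} i j k t
  ... | i<j , j<k , ij , jk , ik = isTriangle⁺ {e ∷ G} i<j j<k (Adj-∷ ij , Adj-∷ jk , Adj-∷ ik)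

  triangles-mono : ∀ G e → triangles G ≤ triangles (e ∷ G)
  triangles-mono G e = subst₂ _≤_ (sym (triangles≡count G)) (sym (triangles≡count (e ∷ G)))
    (count-mono triples (λ {t} _ → isTriangle-mono {G} {e} t))

  triangles-strict-sorted : ∀ {G e i j k} → toℕ i < toℕ j → toℕ j < toℕ k →
    ¬ Triangle G i j k → Triangle (e ∷ G) i j k → triangles G < triangles (e ∷ G)
  triangles-strict-sorted {G} {e} {i} {j} {k} i<j j<k ¬old new =
    subst₂ _<_ (sym (triangles≡count G)) (sym (triangles≡count (e ∷ G)))
    (count-strict triples (λ {t} _ → isTriangle-mono {G} {e} t)
      (∈-cartesianProduct⁺ (∈-allFin i) (∈-cartesianProduct⁺ (∈-allFin j) (∈-allFin k)))
      (λ t → ¬old (proj₂ (proj₂ (isTriangle⁻ {G} i j k t))))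
      (isTriangle⁺ {e ∷ G} i<j j<k new))

  Triangle-swap₁₂ : ∀ {G i j k} → Triangle G i j k → Triangle G j i k
  Triangle-swap₁₂ {G} (ij , jk , ik) = Adj-sym {G = G} ij , ik , jk

  Triangle-swap₂₃ : ∀ {G i j k} → Triangle G i j k → Triangle G i k j
  Triangle-swap₂₃ {G} (ij , jk , ik) = ik , Adj-sym {G = G} jk , ij

  -- Only increasing triples are counted, so the new triangle is first sorted by transpositions.
  triangles-strict : ∀ {G e i j k} → i ≢ j → j ≢ k → i ≢ k →
    ¬ Triangle G i j k → Triangle (e ∷ G) i j k → triangles G < triangles (e ∷ G)
  triangles-strict {G} {e} {i} {j} {k} i≢j j≢k i≢k ¬old new
    with ≢⇒<∨> i≢j | ≢⇒<∨> j≢k | ≢⇒<∨> i≢k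
    where
    ≢⇒<∨> : ∀ {x y : Fin n} → x ≢ y → toℕ x < toℕ y ⊎ toℕ y < toℕ x
    ≢⇒<∨> {x} {y} x≢y with <-cmp (toℕ x) (toℕ y)
    ... | tri< lt _ _ = inj₁ lt
    ... | tri≈ _ eq _ = contradiction (toℕ-injective eq) x≢y
    ... | tri> _ _ gt = inj₂ gt
  ... | inj₁ i<j | inj₁ j<k | _ = triangles-strict-sorted i<j j<k ¬old new
  ... | inj₁ i<j | inj₂ k<j | inj₁ i<k = triangles-strict-sorted i<k k<j
    (¬old ∘ Triangle-swap₂₃ {G}) (Triangle-swap₂₃ {e ∷ G} new)
  ... | inj₁ i<j | inj₂ k<j | inj₂ k<i = triangles-strict-sorted k<i i<j
    (¬old ∘ Triangle-swap₂₃ {G} ∘ Triangle-swap₁₂ {G}) (Triangle-swap₁₂ {e ∷ G} (Triangle-swap₂₃ {e ∷ G} new))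
  ... | inj₂ j<i | inj₁ j<k | inj₁ i<k = triangles-strict-sorted j<i i<k
    (¬old ∘ Triangle-swap₁₂ {G}) (Triangle-swap₁₂ {e ∷ G} new)
  ... | inj₂ j<i | inj₁ j<k | inj₂ k<i = triangles-strict-sorted j<k k<i
    (¬old ∘ Triangle-swap₁₂ {G} ∘ Triangle-swap₂₃ {G}) (Triangle-swap₂₃ {e ∷ G} (Triangle-swap₁₂ {e ∷ G} new))
  ... | inj₂ j<i | inj₂ k<j | _ = triangles-strict-sorted k<j j<i
    (¬old ∘ Triangle-swap₁₂ {G} ∘ Triangle-swap₂₃ {G} ∘ Triangle-swap₁₂ {G})
    (Triangle-swap₁₂ {e ∷ G} (Triangle-swap₂₃ {e ∷ G} (Triangle-swap₁₂ {e ∷ G} new)))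

  valC-≥ : ∀ f C B {e : Edge n} {t} → e ∈ legalC C B → t ≤ valB f (e ∷ C) B → t ≤ valC (suc f) C B
  valC-≥ f C B e∈ t≤ = ≤-trans t≤ (maxOr-≥ (triangles C) _ (∈-map⁺ (λ e → valB f (e ∷ C) B) e∈))

  valB-≤ : ∀ f C B {e : Edge n} {t} → e ∈ unclaimed C B → valC f C (e ∷ B) ≤ t → valB (suc f) C B ≤ t
  valB-≤ f C B e∈ ≤t = ≤-trans (minOr-≤ (triangles C) _ (∈-map⁺ (λ e → valC f C (e ∷ B)) e∈)) ≤t

  module _ (P : ℕ → Set) (f : ℕ) (C B : List (Edge n)) where

    valC-elim : P (triangles C) → (∀ {e} → e ∈ legalC C B → P (valB f (e ∷ C) B)) → P (valC (suc f) C B)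
    valC-elim p₀ p = maxOr-elim P _ p₀ λ y∈ →
      let e , e∈ , eq = ∈-map⁻ (λ e → valB f (e ∷ C) B) y∈ in subst P (sym eq) (p e∈)

    valB-elim : P (triangles C) → (∀ {e} → e ∈ unclaimed C B → P (valC f C (e ∷ B))) → P (valB (suc f) C B)
    valB-elim p₀ p = minOr-elim P _ p₀ λ y∈ →
      let e , e∈ , eq = ∈-map⁻ (λ e → valC f C (e ∷ B)) y∈ in subst P (sym eq) (p e∈)

    -- The free edge rules out the default `triangles C`: in a lower bound the current score may
    -- still be too small, and only the values after a reply satisfy P.
    valB-elim⁺ : ∀ {e} → e ∈ unclaimed C B → (∀ {e} → e ∈ unclaimed C B → P (valC f C (e ∷ B))) →
      P (valB (suc f) C B)
    valB-elim⁺ e∈ p = minOr-elim⁺ P (triangles C) _ (∈-map⁺ (λ e → valC f C (e ∷ B)) e∈) λ y∈ →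
      let e , e∈ , eq = ∈-map⁻ (λ e → valC f C (e ∷ B)) y∈ in subst P (sym eq) (p e∈)

  -- Claimed edges are never lost, so Constructor may stop planning once he has enough triangles.
  triangles≤valC : ∀ f (C B : List (Edge n)) → triangles C ≤ valC f C B
  triangles≤valB : ∀ f (C B : List (Edge n)) → triangles C ≤ valB f C B
  triangles≤valC zero C B = ≤-refl
  triangles≤valC (suc f) C B = valC-elim (triangles C ≤_) f C B ≤-refl
    λ {e} _ → ≤-trans (triangles-mono C e) (triangles≤valB f (e ∷ C) B)
  triangles≤valB zero C B = ≤-refl
  triangles≤valB (suc f) C B = valB-elim (triangles C ≤_) f C B ≤-refl λ {e} _ → triangles≤valC f C (e ∷ B)

-- Constructor's strategy

length*≤sum : {A : Set} (f : A → ℕ) {K : ℕ} (xs : List A) → (∀ {x} → x ∈ xs → K ≤ f x) →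
  length xs * K ≤ sum (map f xs)
length*≤sum f [] _ = z≤n
length*≤sum f (x ∷ xs) K≤ = +-mono-≤ (K≤ (here refl)) (length*≤sum f xs (K≤ ∘ there))

module _ {n : ℕ} where

  private
    Graph : Set
    Graph = List (Edge n)

  -- Neighbours are listed with repetition, so `degree` is an upper bound for their number. This
  -- allows arbitrary edge lists for Blocker, about which Constructor's strategy records only the
  -- length.
  nbrs : Graph → Fin n → List (Fin n)
  nbrs [] v = []
  nbrs ((a , b) ∷ G) v = if v =ᶠ a then b ∷ nbrs G v else if v =ᶠ b then a ∷ nbrs G v else nbrs G v

  degree : Graph → Fin n → ℕ
  degree G v = length (nbrs G v)

  ∈-nbrs : ∀ {G v w} → Adj G v w → w ∈ nbrs G v
  ∈-nbrs {[]} (inj₁ ())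
  ∈-nbrs {[]} (inj₂ ())
  ∈-nbrs {(a , b) ∷ G} {v} {w} vw with v ≟ᶠ a | v ≟ᶠ b | Adj-∷⁻ vw
  ... | yes _ | _     | inj₁ old = there (∈-nbrs old)
  ... | no _  | yes _ | inj₁ old = there (∈-nbrs old)
  ... | no _  | no _  | inj₁ old = ∈-nbrs old
  ... | yes _ | _     | inj₂ (inj₁ (_ , w≡b)) = here w≡b
  ... | no v≢a | _    | inj₂ (inj₁ (v≡a , _)) = contradiction v≡a v≢a
  ... | yes v≡a | _   | inj₂ (inj₂ (v≡b , w≡a)) = here (trans w≡a (trans (sym v≡a) v≡b))
  ... | no _ | yes _  | inj₂ (inj₂ (_ , w≡a)) = here w≡a
  ... | no _ | no v≢b | inj₂ (inj₂ (v≡b , _)) = contradiction v≡b v≢b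

  degree-∷ : ∀ e G v → degree (e ∷ G) v ≤ suc (degree G v)
  degree-∷ (a , b) G v with v =ᶠ a | v =ᶠ b
  ... | true  | _     = ≤-refl
  ... | false | true  = ≤-refl
  ... | false | false = n≤1+n _

  private
    move-suc : ∀ d p q s → suc (d + (p + q + s)) ≡ p + suc q + (d + s)
    move-suc = solve-∀

    move-front : ∀ d p s → d + (p + s) ≡ p + (d + s)
    move-front = solve-∀

  degree-sum-∷ : ∀ a b G vs → sum (map (degree ((a , b) ∷ G)) vs) ≤
    count (_=ᶠ a) vs + count (_=ᶠ b) vs + sum (map (degree G) vs)
  degree-sum-∷ a b G [] = z≤n
  degree-sum-∷ a b G (v ∷ vs) with v =ᶠ a | v =ᶠ b | degree-sum-∷ a b G vs
  -- A loop at v: it lengthens the list of neighbours by one but is counted at both ends, hence the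
  -- slack of one.
  ... | true  | true  | ih = s≤s (≤-trans (+-monoʳ-≤ (degree G v) ih)
    (≤-trans (n≤1+n _) (≤-reflexive (move-suc (degree G v) (count (_=ᶠ a) vs) (count (_=ᶠ b) vs) _))))
  ... | true  | false | ih = s≤s (≤-trans (+-monoʳ-≤ (degree G v) ih)
    (≤-reflexive (move-front (degree G v) (count (_=ᶠ a) vs + count (_=ᶠ b) vs) _)))
  ... | false | true  | ih = ≤-trans (s≤s (+-monoʳ-≤ (degree G v) ih))
    (≤-reflexive (move-suc (degree G v) (count (_=ᶠ a) vs) (count (_=ᶠ b) vs) _))
  ... | false | false | ih = ≤-trans (+-monoʳ-≤ (degree G v) ih)
    (≤-reflexive (move-front (degree G v) (count (_=ᶠ a) vs + count (_=ᶠ b) vs) _))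

  count-≡≤1 : ∀ a {vs : List (Fin n)} → Unique vs → count (_=ᶠ a) vs ≤ 1
  count-≡≤1 a {vs} u = subst (λ c → count (_=ᶠ a) vs ≤ suc c) (count-none {p = λ _ → false} vs λ _ ())
    (count-suc {q = λ _ → false} u λ _ t → inj₂ (toWitness t))

  -- Handshake inequality: in a duplicate-free list each edge is met at most once at either end.
  degree-sum : ∀ G {vs} → Unique vs → sum (map (degree G) vs) ≤ 2 * length G
  degree-sum [] {vs} _ = ≤-reflexive (zeros vs)
    where
    zeros : ∀ vs → sum (map (degree []) vs) ≡ 0
    zeros [] = refl
    zeros (_ ∷ vs) = zeros vs
  degree-sum ((a , b) ∷ G) {vs} u = ≤-trans (degree-sum-∷ a b G vs)
    (≤-trans (+-mono-≤ (+-mono-≤ (count-≡≤1 a u) (count-≡≤1 b u)) (degree-sum G u))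
      (≤-reflexive (sym (*-suc 2 (length G)))))

  -- With h + 1 vertices of degree at least K the degree sum would be at least (h + 1)K, too much
  -- for the number of edges. So `avoid` together with all vertices of high degree does not exhaust
  -- the n vertices.
  ∃-low-degree : ∀ G {K h} (avoid : List (Fin n)) → 2 * length G < suc h * K → length avoid + h < n →
    ∃ λ v → v ∉ avoid × degree G v < K
  ∃-low-degree G {K} {h} avoid sparse room
    with length<⇒∃∉ (avoid ++ high) (<-≤-trans (s≤s (≤-trans (≤-reflexive (length-++ avoid)) (+-monoʳ-≤ _ few))) room)
    where
    high : List (Fin n)
    high = filter (λ v → K ≤? degree G v) (allFin n)
    few : length high ≤ h
    few = ≤-pred (*-cancelʳ-< K (length high) (suc h) (≤-<-trans
      (≤-trans (length*≤sum (degree G) high (λ x∈ → proj₂ (∈-filter⁻ (λ v → K ≤? degree G v) {xs = allFin n} x∈)))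
        (degree-sum G (Unique.filter⁺ (λ v → K ≤? degree G v) (Unique.allFin⁺ n)))) sparse))
  ... | v , v∉ = v , v∉ ∘ ∈-++⁺ˡ , ≰⇒> λ K≤ → v∉ (∈-++⁺ʳ avoid (∈-filter⁺ (λ v → K ≤? degree G v) (∈-allFin v) K≤))

  Closed-edge : ∀ {G : Graph} {S u v} → u ∈ S → v ∈ S → Closed G S → Closed (edge u v ∷ G) S
  Closed-edge u∈ v∈ closed xy x∈ with Adj-edge⁻ xy
  ... | inj₁ old = closed old x∈
  ... | inj₂ (inj₁ (_ , refl)) = v∈
  ... | inj₂ (inj₂ (_ , refl)) = u∈

  -- A path through the new edge would stay inside S, which is too small for five vertices.
  Closed⇒¬Path₅ : ∀ {G : Graph} {S u v} → length S ≤ 4 → u ∈ S → v ∈ S → Closed G S → ¬ Path₅ G → ¬ Path₅ (edge u v ∷ G)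
  Closed⇒¬Path₅ {G} {S} {u} {v} small u∈ v∈ closed noP (path {a} {b} {c} {d} {e} dist ab bc cd de)
    with a ∈? S
  ... | yes a∈ = <⇒≱ (s≤s small) (Unique∧⊆⇒length≤ dist λ
        { (here refl) → a∈
        ; (there (here refl)) → b∈
        ; (there (there (here refl))) → c∈
        ; (there (there (there (here refl)))) → d∈
        ; (there (there (there (there (here refl))))) → closed′ de d∈ })
    where
    closed′ : Closed (edge u v ∷ G) S
    closed′ = Closed-edge {G} u∈ v∈ closed
    b∈ : b ∈ S
    b∈ = closed′ ab a∈
    c∈ : c ∈ S
    c∈ = closed′ bc b∈
    d∈ : d ∈ S
    d∈ = closed′ cd c∈
  ... | no a∉ = noP (path dist (old ab a∉) (old bc b∉) (old cd c∉) (old de d∉))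
    where
    closed′ : Closed (edge u v ∷ G) S
    closed′ = Closed-edge {G} u∈ v∈ closed
    outside : ∀ {x y} → Adj (edge u v ∷ G) x y → x ∉ S → y ∉ S
    outside xy x∉ y∈ = x∉ (closed′ (Adj-sym {G = edge u v ∷ G} xy) y∈)
    old : ∀ {x y} → Adj (edge u v ∷ G) x y → x ∉ S → Adj G x y
    old xy x∉ with Adj-edge⁻ xy
    ... | inj₁ xy = xy
    ... | inj₂ (inj₁ (refl , _)) = contradiction u∈ x∉
    ... | inj₂ (inj₂ (refl , _)) = contradiction v∈ x∉
    b∉ : b ∉ S
    b∉ = outside ab a∉
    c∉ : c ∉ S
    c∉ = outside bc b∉
    d∉ : d ∉ S
    d∉ = outside cd c∉

  play : ∀ {t} f C B {u v : Fin n} → Free C B u v → ¬ Path₅ (edge u v ∷ C) →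
    length (unclaimed C B) ≤ f →
    (∀ f → length (unclaimed (edge u v ∷ C) B) ≤ f → t ≤ valB f (edge u v ∷ C) B) →
    t ≤ valC f C B
  play f C B {u} {v} free noP fuel k with <-≤-trans (unclaimed-shrinks C B (edge u v ∷ C) B (Free⇒unclaimed free) there id (inj₁ (here refl))) fuel
  play (suc f) C B free noP fuel k | s≤s fuel′ = valC-≥ f C B (∈-legalC⁺ {C = C} {B = B} (Free⇒unclaimed free) noP) (k f fuel′)

  reply : ∀ {t} f C B {u v : Fin n} → Free C B u v → length (unclaimed C B) ≤ f →
    (∀ f e → length (unclaimed C (e ∷ B)) ≤ f → t ≤ valC f C (e ∷ B)) →
    t ≤ valB f C B
  reply zero C B {u} {v} free fuel k with () ← <-≤-trans (unclaimed-shrinks C B (edge u v ∷ C) B (Free⇒unclaimed free) there id (inj₁ (here refl))) fuel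
  reply {t} (suc f) C B free fuel k = valB-elim⁺ (t ≤_) f C B (Free⇒unclaimed free) λ {e} e∈ →
    k f e (≤-pred (<-≤-trans (unclaimed-shrinks C B C (e ∷ B) e∈ id there (inj₂ (here refl))) fuel))

  Touched : Graph → List (Fin n) → Set
  Touched C S = ∀ {x y} → Adj C x y → x ∈ S

  Touched-edge : ∀ {C S S′ u v} → S ⊆ S′ → u ∈ S′ → v ∈ S′ → Touched C S → Touched (edge u v ∷ C) S′
  Touched-edge S⊆ u∈ v∈ touched xy with Adj-edge⁻ xy
  ... | inj₁ old = S⊆ (touched old)
  ... | inj₂ (inj₁ (refl , _)) = u∈
  ... | inj₂ (inj₂ (refl , _)) = v∈

  untouched⇒¬Adj : ∀ {C S u v} → Touched C S → v ∉ S → ¬ Adj C u v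
  untouched⇒¬Adj {C} touched v∉ uv = v∉ (touched (Adj-sym {G = C} uv))

abstract

  room-shuffle : ∀ k u h → suc (3 * k + 9 + u + h) ≡ u + h + (3 * k + 10)
  room-shuffle = solve-∀

  -- P holds the vertices forbidden by the current block and T the used ones. The bound on P covers
  -- the largest case, three vertices with their Blocker neighbourhoods of size at most k + 1, that
  -- is 3 + 3(k + 1).
  length-++<room : ∀ {A : Set} (P : List A) {T : List A} k t {h n} → length P ≤ 3 * k + 9 → length T ≤ 4 * t →
    4 * t + h + (3 * k + 10) ≤ n → length (P ++ T) + h < n
  length-++<room P k t {h} P≤ T≤ room =
    ≤-trans (s≤s (+-monoˡ-≤ h (≤-trans (≤-reflexive (length-++ P)) (+-mono-≤ P≤ T≤))))
      (≤-trans (≤-reflexive (room-shuffle k (4 * t) h)) room)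

  three-suc : ∀ k → 3 + (suc k + (suc k + suc k)) ≡ 3 * k + 6
  three-suc = solve-∀

  length-++₃≤ : ∀ {A : Set} k (xs ys zs : List A) → length xs ≤ suc k → length ys ≤ suc k → length zs ≤ suc k →
    3 + length (xs ++ ys ++ zs) ≤ 3 * k + 9
  length-++₃≤ k xs ys zs x≤ y≤ z≤ = ≤-trans
    (+-monoʳ-≤ 3 (≤-trans (≤-reflexive (trans (length-++ xs) (cong (length xs +_) (length-++ ys))))
      (+-mono-≤ x≤ (+-mono-≤ y≤ z≤))))
    (≤-trans (≤-reflexive (three-suc k)) (+-monoʳ-≤ (3 * k) (m≤n+m 6 3)))

  2+≤ : ∀ k {d} → d ≤ k → 2 + d ≤ 3 * k + 9
  2+≤ k {d} d≤ = ≤-trans (≤-reflexive (+-comm 2 d)) (+-mono-≤ (≤-trans d≤ (m≤m+n k (2 * k))) (s≤s (s≤s z≤n)))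

  k≤3*k+9 : ∀ k → k ≤ 3 * k + 9
  k≤3*k+9 k = ≤-trans (m≤m+n k (2 * k)) (m≤m+n (3 * k) 9)

  +4*m≤4*t : ∀ {m t c} → m < t → c ≤ 4 → c + 4 * m ≤ 4 * t
  +4*m≤4*t {m} m<t c≤4 = ≤-trans (+-monoˡ-≤ (4 * m) c≤4) (≤-trans (≤-reflexive (sym (*-suc 4 m))) (*-monoʳ-≤ 4 m<t))

-- K separates low from high Blocker degree and h bounds the number of vertices of degree ≥ K.
module Constructor {n : ℕ} (K h t : ℕ) (sparse : 2 * (4 * t) < suc h * K) (room : 4 * t + h + (3 * K + 10) ≤ n) where

  private
    Graph : Set
    Graph = List (Edge n)

  -- Blocker owns at most 4t edges while the t blocks are built, so `sparse` leaves at most h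
  -- vertices of degree K or more, and `room` accounts for these, for P and for T.
  choose : ∀ (P T : List (Fin n)) B → length P ≤ 3 * K + 9 → length T ≤ 4 * t → length B ≤ 4 * t →
    ∃ λ v → v ∉ P × v ∉ T × degree B v < K
  choose P T B P≤ T≤ B≤ =
    let v , v∉ , low = ∃-low-degree B {K} {h} (P ++ T) (≤-<-trans (*-monoʳ-≤ 2 B≤) sparse) (length-++<room P K t P≤ T≤ room)
    in v , v∉ ∘ ∈-++⁺ˡ , v∉ ∘ ∈-++⁺ʳ P , low

  -- Serves to show that Blocker can always reply; if he could not, the game would end at the
  -- current score. An untouched v has no edge of Constructor, and it is chosen outside Blocker's
  -- neighbourhood of u.
  ∃-Free : ∀ (C B : Graph) T → Touched C T → length T ≤ 4 * t → length B ≤ 4 * t → ∃₂ λ u v → Free C B u v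
  ∃-Free C B T touched T≤ B≤ with choose [] T B z≤n T≤ B≤
  ... | u , _ , _ , low with choose (u ∷ nbrs B u) T B
    (≤-trans low (k≤3*k+9 K)) T≤ B≤
  ... | v , v∉ , v∉T , _ = u , v , mkFree (v∉ ∘ here ∘ sym) (untouched⇒¬Adj {C = C} touched v∉T) (v∉ ∘ there ∘ ∈-nbrs)

  -- S is the block under construction and T the set of vertices of the finished blocks.
  record Stage (m c : ℕ) (C B : Graph) (S T : List (Fin n)) : Set where
    field
      noP     : ¬ Path₅ C
      touched : Touched C (S ++ T)
      closed  : Closed C S
      S≤      : length S ≤ 4
      T≤      : length T ≤ 4 * m
      -- The index c is the number of rounds spent on the current block; each of the m finished
      -- blocks took four.
      B≤      : length B ≤ c + 4 * m
      found   : m ≤ triangles C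
  open Stage

  module _ {m : ℕ} (m<t : m < t) where

    choose′ : ∀ {c C B S T} → c ≤ 4 → Stage m c C B S T → (P : List (Fin n)) → length P ≤ 3 * K + 9 →
      ∃ λ v → v ∉ P × v ∉ T × degree B v < K
    choose′ {B = B} {T = T} c≤4 s P P≤ =
      choose P T B P≤ (≤-trans (T≤ s) (+4*m≤4*t m<t z≤n)) (≤-trans (B≤ s) (+4*m≤4*t m<t c≤4))

    add-vertex : ∀ {c C B S T v} → length S ≤ 3 → v ∉ S → v ∉ T → Stage m c C B S T → Stage m c C B (v ∷ S) T
    add-vertex {C = C} {S = S} S≤3 v∉S v∉T s = record
      { noP = noP s
      ; touched = there ∘ touched s
      ; closed = λ { xy (here refl) → contradiction (touched s xy) v∉
                   ; xy (there x∈) → there (closed s xy x∈) }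
      ; S≤ = s≤s S≤3 ; T≤ = T≤ s ; B≤ = B≤ s ; found = found s }
      where
      v∉ : _ ∉ S ++ _
      v∉ v∈ with ∈-++⁻ S v∈
      ... | inj₁ v∈S = v∉S v∈S
      ... | inj₂ v∈T = v∉T v∈T

    -- One round inside the block. Legality is automatic: S is closed and has at most four vertices,
    -- too few for a `Path₅` through the new edge.
    move : ∀ {c C B S T u v f} → c ≤ 3 → u ∈ S → v ∈ S → Free C B u v → Stage m c C B S T →
      length (unclaimed C B) ≤ f →
      (∀ f e → Stage m (suc c) (edge u v ∷ C) (e ∷ B) S T → length (unclaimed (edge u v ∷ C) (e ∷ B)) ≤ f →
        t ≤ valC f (edge u v ∷ C) (e ∷ B)) →
      t ≤ valC f C B
    move {c} {C} {B} {S} {T} {u} {v} {f} c≤3 u∈ v∈ free s fuel k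
      with ∃-Free (edge u v ∷ C) B (S ++ T)
        (Touched-edge {C = C} {S′ = S ++ T} id (∈-++⁺ˡ u∈) (∈-++⁺ˡ v∈) (touched s))
        (≤-trans (≤-reflexive (length-++ S)) (≤-trans (+-monoʳ-≤ (length S) (T≤ s)) (+4*m≤4*t m<t (S≤ s))))
        (≤-trans (B≤ s) (+4*m≤4*t m<t (m≤n⇒m≤1+n c≤3)))
    ... | _ , _ , spare = play f C B free noP′ fuel λ f fuel → reply f (edge u v ∷ C) B spare fuel λ f e fuel →
        k f e (record
          { noP = noP′
          ; touched = Touched-edge {C = C} {S′ = S ++ T} id (∈-++⁺ˡ u∈) (∈-++⁺ˡ v∈) (touched s)
          ; closed = Closed-edge {G = C} u∈ v∈ (closed s)
          ; S≤ = S≤ s ; T≤ = T≤ s ; B≤ = s≤s (B≤ s)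
          ; found = ≤-trans (found s) (triangles-mono C (edge u v)) }) fuel
      where
      noP′ : ¬ Path₅ (edge u v ∷ C)
      noP′ = Closed⇒¬Path₅ {G = C} (S≤ s) u∈ v∈ (closed s) (noP s)

    fresh⇒¬Adj : ∀ {c C B S T u v} → Stage m c C B S T → v ∉ S → v ∉ T → ¬ Adj C u v
    fresh⇒¬Adj {C = C} {S = S} s v∉S v∉T uv with ∈-++⁻ S (touched s (Adj-sym {G = C} uv))
    ... | inj₁ v∈S = v∉S v∈S
    ... | inj₂ v∈T = v∉T v∈T

    module _ (next : ∀ {f C B T} → Stage (suc m) 0 C B [] T → length (unclaimed C B) ≤ f → t ≤ valC f C B) where

      -- The fourth round: vw completes the triangle on y, v, w. The whole block then joins T, so
      -- that later blocks stay disjoint from it and a new block starts with empty S.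
      close : ∀ {f C B S T y v w} → Stage m 3 C B S T → v ∈ S → w ∈ S → v ≢ y → v ≢ w → w ≢ y →
        Adj C y v → Adj C y w → ¬ Adj C v w → ¬ Adj B v w → length (unclaimed C B) ≤ f → t ≤ valC f C B
      close {f} {C} {B} {S} {T} {y} {v} {w} s v∈ w∈ v≢y v≢w w≢y yv yw vw∉C vw∉B fuel =
        move ≤-refl v∈ w∈ (mkFree v≢w vw∉C vw∉B) s fuel λ f e s′ fuel → next record
          { noP = noP s′
          ; touched = touched s′
          ; closed = λ _ ()
          ; S≤ = z≤n
          ; T≤ = ≤-trans (≤-reflexive (length-++ S)) (≤-trans (+-mono-≤ (S≤ s) (T≤ s)) (≤-reflexive (sym (*-suc 4 m))))
          ; B≤ = ≤-trans (B≤ s′) (≤-reflexive (sym (*-suc 4 m)))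
          ; found = ≤-trans (s≤s (found s)) (triangles-strict {G = C} {i = y} {j = v} {k = w} (≢-sym v≢y) v≢w (≢-sym w≢y)
              (vw∉C ∘ proj₁ ∘ proj₂) (Adj-∷ yv , edge-Adj v w , Adj-∷ yw))
          } fuel

      ¬both : ∀ {B : Graph} {x z w} e → ¬ Adj B x w → ¬ Adj B z w → x ≢ z → x ≢ w → Adj (e ∷ B) x w → ¬ Adj (e ∷ B) z w
      ¬both e ¬xw ¬zw x≢z x≢w xw zw with Adj-∷⁻ xw | Adj-∷⁻ zw
      ... | inj₁ old | _ = ¬xw old
      ... | _ | inj₁ old = ¬zw old
      ... | inj₂ (inj₁ (refl , refl)) | inj₂ (inj₁ (z≡x , _)) = x≢z (sym z≡x)
      ... | inj₂ (inj₁ (refl , refl)) | inj₂ (inj₂ (_ , w≡x)) = x≢w (sym w≡x)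
      ... | inj₂ (inj₂ (refl , refl)) | inj₂ (inj₁ (_ , w≡x)) = x≢w (sym w≡x)
      ... | inj₂ (inj₂ (refl , refl)) | inj₂ (inj₂ (z≡x , _)) = x≢z (sym z≡x)

      -- The bound `suc K`: x and y had degree below K when chosen, and each of the two replies
      -- since then added at most one; z has seen only one reply. Since w avoids the Blocker
      -- neighbours of all three, the reply to yw can spoil only one of xw and zw, and `finish`
      -- closes the triangle with the other.
      third-leaf : ∀ {f C B T y x z} → y ≢ x → z ≢ x → z ≢ y → Adj C y x → Adj C y z →
        degree B y ≤ suc K → degree B x ≤ suc K → degree B z ≤ suc K →
        Stage m 2 C B (z ∷ x ∷ y ∷ []) T → length (unclaimed C B) ≤ f → t ≤ valC f C B
      third-leaf {f} {C} {B} {T} {y} {x} {z} y≢x z≢x z≢y yx yz y≤ x≤ z≤ s fuel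
        with choose′ (s≤s (s≤s z≤n)) s (y ∷ x ∷ z ∷ nbrs B y ++ nbrs B x ++ nbrs B z) bound
        where
        bound : 3 + length (nbrs B y ++ nbrs B x ++ nbrs B z) ≤ 3 * K + 9
        bound = length-++₃≤ K (nbrs B y) (nbrs B x) (nbrs B z) y≤ x≤ z≤
      ... | w , w∉ , w∉T , _ =
        move (s≤s (s≤s z≤n)) (there (there (there (here refl)))) (here refl)
          (mkFree (≢-sym w≢y) (fresh⇒¬Adj s w∉S w∉T) (w∉nbrs ∘ ∈-++⁺ˡ ∘ ∈-nbrs))
          (add-vertex ≤-refl w∉S w∉T s) fuel λ f e s′ fuel → finish f e s′ fuel (Adj? (e ∷ B) x w)
        where
        w≢y = w∉ ∘ here
        w≢x = w∉ ∘ there ∘ here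
        w≢z = w∉ ∘ there ∘ there ∘ here
        w∉nbrs = w∉ ∘ there ∘ there ∘ there
        w∉S : w ∉ z ∷ x ∷ y ∷ []
        w∉S (here w≡z) = w≢z w≡z
        w∉S (there (here w≡x)) = w≢x w≡x
        w∉S (there (there (here w≡y))) = w≢y w≡y
        ¬vw : ∀ {v} → v ≢ y → v ≢ w → ¬ Adj (edge y w ∷ C) v w
        ¬vw v≢y v≢w vw with Adj-edge⁻ {G = C} vw
        ... | inj₁ old = fresh⇒¬Adj s w∉S w∉T old
        ... | inj₂ (inj₁ (v≡y , _)) = v≢y v≡y
        ... | inj₂ (inj₂ (v≡w , _)) = v≢w v≡w
        finish : ∀ f e → Stage m 3 (edge y w ∷ C) (e ∷ B) (w ∷ z ∷ x ∷ y ∷ []) T →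
          length (unclaimed (edge y w ∷ C) (e ∷ B)) ≤ f → Dec (Adj (e ∷ B) x w) → t ≤ valC f (edge y w ∷ C) (e ∷ B)
        finish f e s′ fuel (no xw∉) =
          close s′ (there (there (here refl))) (here refl) (≢-sym y≢x) (≢-sym w≢x) w≢y
            (Adj-∷ yx) (edge-Adj y w) (¬vw (≢-sym y≢x) (≢-sym w≢x)) xw∉ fuel
        finish f e s′ fuel (yes xw) =
          close s′ (there (here refl)) (here refl) z≢y (≢-sym w≢z) w≢y
            (Adj-∷ yz) (edge-Adj y w) (¬vw z≢y (≢-sym w≢z))
            (¬both e (w∉nbrs ∘ ∈-++⁺ʳ (nbrs B y) ∘ ∈-++⁺ˡ ∘ ∈-nbrs)
              (w∉nbrs ∘ ∈-++⁺ʳ (nbrs B y) ∘ ∈-++⁺ʳ (nbrs B x) ∘ ∈-nbrs) (≢-sym z≢x) (≢-sym w≢x) xw) fuel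

      second-leaf : ∀ {f C B T y x} → y ≢ x → Adj C y x → degree B y ≤ K → degree B x ≤ K →
        Stage m 1 C B (x ∷ y ∷ []) T → length (unclaimed C B) ≤ f → t ≤ valC f C B
      second-leaf {f} {C} {B} {T} {y} {x} y≢x yx y≤ x≤ s fuel
        with choose′ (s≤s z≤n) s (x ∷ y ∷ nbrs B y) (2+≤ K y≤)
      ... | z , z∉ , z∉T , z-low =
        move (s≤s z≤n) (there (there (here refl))) (here refl)
          (mkFree (≢-sym z≢y) (fresh⇒¬Adj s z∉S z∉T) (z∉ ∘ there ∘ there ∘ ∈-nbrs))
          (add-vertex (s≤s (s≤s z≤n)) z∉S z∉T s) fuel λ f e s′ fuel →
          third-leaf y≢x z≢x z≢y (Adj-∷ yx) (edge-Adj y z)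
            (≤-trans (degree-∷ e B y) (s≤s y≤)) (≤-trans (degree-∷ e B x) (s≤s x≤))
            (≤-trans (degree-∷ e B z) (m≤n⇒m≤1+n z-low)) s′ fuel
        where
        z≢x = z∉ ∘ here
        z≢y = z∉ ∘ there ∘ here
        z∉S : z ∉ x ∷ y ∷ []
        z∉S (here z≡x) = z≢x z≡x
        z∉S (there (here z≡y)) = z≢y z≡y

      phase : ∀ {f C B T} → Stage m 0 C B [] T → length (unclaimed C B) ≤ f → t ≤ valC f C B
      phase {f} {C} {B} {T} s fuel with choose′ z≤n s [] z≤n
      ... | y , _ , y∉T , y-low with choose′ z≤n s (y ∷ nbrs B y)
          (≤-trans y-low (k≤3*k+9 K))
      ... | x , x∉ , x∉T , x-low =
        move z≤n (there (here refl)) (here refl)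
          (mkFree (x∉ ∘ here ∘ sym) (fresh⇒¬Adj s (λ ()) x∉T) (x∉ ∘ there ∘ ∈-nbrs))
          (add-vertex (s≤s z≤n) (λ { (here x≡y) → x∉ (here x≡y) ; (there ()) }) x∉T (add-vertex z≤n (λ ()) y∉T s)) fuel
          λ f e s′ fuel → second-leaf (x∉ ∘ here ∘ sym) (edge-Adj y x)
            (≤-trans (degree-∷ e B y) y-low) (≤-trans (degree-∷ e B x) x-low) s′ fuel

  forces : ∀ j {m f C B T} → m + j ≡ t → Stage m 0 C B [] T → length (unclaimed C B) ≤ f → t ≤ valC f C B
  forces zero {m} {f} {C} {B} eq s fuel =
    subst (_≤ valC f C B) (trans (sym (+-identityʳ m)) eq) (≤-trans (found s) (triangles≤valC f C B))
  forces (suc j) {m} eq s fuel = phase (subst (suc m ≤_) eq′ (m≤m+n (suc m) j)) (forces j eq′) s fuel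
    where
    eq′ : suc m + j ≡ t
    eq′ = trans (sym (+-suc m j)) eq

  t≤g : t ≤ g n
  t≤g = forces t {0} {T = []} refl record
    { noP = λ { (path _ (inj₁ ()) _ _ _) ; (path _ (inj₂ ()) _ _ _) }
    ; touched = λ { (inj₁ ()) ; (inj₂ ()) }
    ; closed = λ _ () ; S≤ = z≤n ; T≤ = z≤n ; B≤ = z≤n ; found = z≤n
    } (length-filter _ (allEdges n))

-- Blocker's strategy

-- The binomial coefficient k(k - 1)/2, in the recursion that follows `size` along a list.
choose₂ : ℕ → ℕ
choose₂ zero = 0
choose₂ (suc k) = k + choose₂ k

shuffle₄ : ∀ a b c d → a + b + (c + d) ≡ a + c + (b + d)
shuffle₄ = solve-∀

count-filter : {A : Set} {p : A → Bool} {P : A → Set} (P? : ∀ x → Dec (P x)) (xs : List A) →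
  (∀ {x} → x ∈ xs → T (p x) → P x) → count p xs ≤ count p (filter P? xs)
count-filter P? [] _ = z≤n
count-filter {p = p} P? (x ∷ xs) imp with P? x
... | yes _ with p x
...   | true  = s≤s (count-filter P? xs (imp ∘ there))
...   | false = count-filter P? xs (imp ∘ there)
count-filter {p = p} P? (x ∷ xs) imp | no ¬px with p x in eq
...   | true  = contradiction (imp (here refl) (subst T (sym eq) tt)) ¬px
...   | false = count-filter P? xs (imp ∘ there)

length-filter-split : {A : Set} {P : A → Set} (P? : ∀ x → Dec (P x)) (xs : List A) →
  length (filter P? xs) + length (filter (¬? ∘ P?) xs) ≡ length xs
length-filter-split P? [] = refl
length-filter-split P? (x ∷ xs) with P? x
... | yes _ = cong suc (length-filter-split P? xs)
... | no _  = trans (+-suc _ _) (cong suc (length-filter-split P? xs))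

module _ {n : ℕ} where

  private
    Graph : Set
    Graph = List (Edge n)

  -- The c(S) and b(S) of the overview. For duplicate-free S each pair is examined once, at the end
  -- that comes first in S, so repetitions in G have no effect.
  size : Graph → List (Fin n) → ℕ
  size G [] = 0
  size G (x ∷ S) = count (adj G x) S + size G S

  size-mono : ∀ {G H : Graph} S → (∀ {x y} → x ∈ S → y ∈ S → Adj G x y → Adj H x y) → size G S ≤ size H S
  size-mono [] _ = z≤n
  size-mono {G} (x ∷ S) imp = +-mono-≤
    (count-mono S λ y∈ t → adj⁺ (imp (here refl) (there y∈) (adj⁻ {G = G} t)))
    (size-mono S λ x∈ y∈ → imp (there x∈) (there y∈))

  size-edge : ∀ {G : Graph} {u v S} → u ≢ v → u ∈ S → v ∈ S → ¬ Adj G u v → size G S < size (edge u v ∷ G) S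
  size-edge {G} {u} {v} {x ∷ S} u≢v u∈ v∈ ¬uv = go u∈ v∈
    where
    G′ = edge u v ∷ G
    adj-mono : ∀ x {y} → T (adj G x y) → T (adj G′ x y)
    adj-mono x {y} t = adj⁺ {G = G′} {u = x} {y} (Adj-∷ (adj⁻ {G = G} {u = x} {y} t))
    rest : size G S ≤ size G′ S
    rest = size-mono {G} {G′} S λ _ _ → Adj-∷
    go : u ∈ x ∷ S → v ∈ x ∷ S → size G (x ∷ S) < size G′ (x ∷ S)
    go (here refl) (here refl) = contradiction refl u≢v
    go (here refl) (there v∈) = +-mono-<-≤
      (count-strict S (λ _ → adj-mono u) v∈ (¬uv ∘ adj⁻) (adj⁺ (edge-Adj {G = G} u v))) rest
    go (there u∈) (here refl) = +-mono-<-≤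
      (count-strict S (λ _ → adj-mono v) u∈ (¬uv ∘ Adj-sym {G = G} ∘ adj⁻)
        (adj⁺ (Adj-sym {G = G′} (edge-Adj {G = G} u v)))) rest
    go (there u∈) (there v∈) = +-mono-≤-< (count-mono S (λ _ → adj-mono x)) (size-edge u≢v u∈ v∈ ¬uv)

  size-∷-outside : ∀ {G : Graph} {u v S} → ¬ (u ∈ S × v ∈ S) → size ((u , v) ∷ G) S ≤ size G S
  size-∷-outside {G} {u} {v} {S} ¬in = size-mono S λ x∈ y∈ xy → case Adj-∷⁻ {G = G} xy of λ
    { (inj₁ old) → old
    ; (inj₂ (inj₁ (refl , refl))) → contradiction (x∈ , y∈) ¬in
    ; (inj₂ (inj₂ (refl , refl))) → contradiction (y∈ , x∈) ¬in }

  size-∷ : ∀ {G : Graph} {u v S} → Unique S → size ((u , v) ∷ G) S ≤ suc (size G S)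
  size-∷ {S = []} _ = z≤n
  size-∷ {G} {u} {v} {x ∷ S} (x∉ ∷ uniq) = go (x ≟ᶠ u) (x ≟ᶠ v)
    where
    G′ = (u , v) ∷ G
    new : ∀ {y} → T (adj G′ x y) → T (adj G x y) ⊎ ((x ≡ u × y ≡ v) ⊎ (x ≡ v × y ≡ u))
    new {y} t = Sum.map₁ (adj⁺ {G = G} {u = x} {y}) (Adj-∷⁻ {G = G} (adj⁻ {G = G′} {u = x} {y} t))
    go : Dec (x ≡ u) → Dec (x ≡ v) → size G′ (x ∷ S) ≤ suc (size G (x ∷ S))
    go (no x≢u) (no x≢v) = ≤-trans
      (+-mono-≤ (count-mono S λ _ t → [ id , [ (λ (x≡u , _) → contradiction x≡u x≢u)
                                             , (λ (x≡v , _) → contradiction x≡v x≢v) ]′ ]′ (new t))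
        (size-∷ uniq))
      (≤-reflexive (+-suc _ _))
    go (yes x≡u) _ = +-mono-≤
      (count-suc {v = v} uniq λ y∈ t → Sum.map₂ [ proj₂ , (λ (_ , y≡u) →
        contradiction (trans x≡u (sym y≡u)) (All.lookup x∉ y∈)) ]′ (new t))
      (size-∷-outside {G} λ (u∈ , _) → All.lookup x∉ u∈ x≡u)
    go (no _) (yes x≡v) = +-mono-≤
      (count-suc {v = u} uniq λ y∈ t → Sum.map₂ [ (λ (_ , y≡v) →
        contradiction (trans x≡v (sym y≡v)) (All.lookup x∉ y∈)) , proj₂ ]′ (new t))
      (size-∷-outside {G} λ (_ , v∈) → All.lookup x∉ v∈ x≡v)

  size-disjoint : ∀ {C B : Graph} S → (∀ {x y} → Adj C x y → Adj B x y → ⊥) → size C S + size B S ≤ choose₂ (length S)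
  size-disjoint [] _ = z≤n
  size-disjoint {C} {B} (x ∷ S) dis = ≤-trans
    (≤-reflexive (shuffle₄ (count (adj C x) S) (size C S) (count (adj B x) S) (size B S)))
    (+-mono-≤ (count-disjoint S λ {y} _ p q → dis (adj⁻ {u = x} {y} p) (adj⁻ {u = x} {y} q)) (size-disjoint S dis))

  size-cover : ∀ (C B : Graph) S → Unique S →
    (∃₂ λ x y → x ∈ S × y ∈ S × Free C B x y) ⊎ choose₂ (length S) ≤ size C S + size B S
  size-cover C B [] _ = inj₂ z≤n
  size-cover C B (x ∷ S) (x∉ ∷ u) with count-cover {p = adj C x} {q = adj B x} S | size-cover C B S u
  ... | inj₁ (y , y∈ , ¬C , ¬B) | _ =
    inj₁ (x , y , here refl , there y∈ , mkFree (All.lookup x∉ y∈) (¬C ∘ adj⁺) (¬B ∘ adj⁺))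
  ... | inj₂ _ | inj₁ (y , z , y∈ , z∈ , free) = inj₁ (y , z , there y∈ , there z∈ , free)
  ... | inj₂ p | inj₂ q = inj₂ (≤-trans (+-mono-≤ p q)
    (≤-reflexive (shuffle₄ (count (adj C x) S) (count (adj B x) S) (size C S) (size B S))))

  -- No edge joins the closed set R to its complement, so every edge inside S lies inside one of the
  -- two parts.
  size-split : ∀ {G : Graph} {R} S → Closed G R →
    size G S ≤ size G (filter (_∈? R) S) + size G (filter (_∉? R) S)
  size-split [] _ = z≤n
  size-split {G} {R} (x ∷ S) closed with x ∈? R
  ... | yes x∈ = ≤-trans
      (+-mono-≤ (count-filter (_∈? R) S λ _ t → closed (adj⁻ {G = G} {u = x} t) x∈) (size-split S closed))
      (≤-reflexive (sym (+-assoc (count (adj G x) (filter (_∈? R) S)) _ _)))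
  ... | no x∉ = ≤-trans
      (+-mono-≤ (count-filter (_∉? R) S λ _ t y∈ → x∉ (closed (Adj-sym {G = G} (adj⁻ t)) y∈)) (size-split S closed))
      (≤-reflexive (shuffle (count (adj G x) (filter (_∉? R) S)) (size G (filter (_∈? R) S)) _))
    where
    shuffle : ∀ a b c → a + (b + c) ≡ b + (a + c)
    shuffle = solve-∀

abstract

  three-or-four : ∀ {l} → 3 ≤ l → l ≤ 4 → l ≡ 3 ⊎ l ≡ 4
  three-or-four {1} (s≤s ()) _
  three-or-four {2} (s≤s (s≤s ())) _
  three-or-four {3} _ _ = inj₁ refl
  three-or-four {4} _ _ = inj₂ refl
  three-or-four {suc (suc (suc (suc (suc _))))} _ (s≤s (s≤s (s≤s (s≤s ()))))

  -- If s ≥ 3, then s + b ≤ 3 forces b = 0, and the first hypothesis gives s ≤ 2. Hence a closed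
  -- triple spans no triangle even before Blocker has replied.
  small-bound : ∀ {s b} → s + 2 ≤ suc (b + 3) → s + b ≤ 3 → s + 1 ≤ 3
  small-bound {0} _ _ = s≤s z≤n
  small-bound {1} _ _ = s≤s (s≤s z≤n)
  small-bound {2} _ _ = ≤-refl
  small-bound {suc (suc (suc s))} {zero} (s≤s (s≤s (s≤s p))) _ with s≤s () ← subst (_≤ 1) (+-comm s 2) p
  small-bound {suc (suc (suc s))} {suc b} _ (s≤s (s≤s (s≤s p))) with () ← subst (_≤ 0) (+-suc s b) p

  -- Otherwise s = b + l − 1 and s + b = choose₂ l, whose parities disagree for l = 3 and l = 4.
  full-balanced : ∀ {s b l} → 3 ≤ l → l ≤ 4 → s + b ≤ choose₂ l → choose₂ l ≤ s + b →
    s + 2 ≤ suc (b + l) → s + 2 ≤ b + l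
  full-balanced {s} {b} {l} 3≤l l≤4 sb≤ ≤sb s≤ = decidable-stable (s + 2 ≤? b + l) λ s≰ →
    parity (three-or-four 3≤l l≤4) (≤-antisym sb≤ ≤sb) (≤-antisym s≤ (≰⇒> s≰))
    where
    parity : ∀ {l} → l ≡ 3 ⊎ l ≡ 4 → s + b ≡ choose₂ l → s + 2 ≡ suc (b + l) → ⊥
    parity (inj₁ refl) sum≡ s≡ = even≢odd (suc b) 1 (trans (shuffle b)
      (trans (cong (_+ b) (sym (+-cancelʳ-≡ 2 s (b + 2) (trans s≡ (sym (trans (+-assoc b 2 2) (+-suc b 3))))))) sum≡))
      where
      shuffle : ∀ b → 2 * suc b ≡ b + 2 + b
      shuffle = solve-∀
    parity (inj₂ refl) sum≡ s≡ = even≢odd 3 (suc b) (sym (trans (shuffle b)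
      (trans (cong (_+ b) (sym (+-cancelʳ-≡ 2 s (b + 3) (trans s≡ (sym (trans (+-assoc b 3 2) (+-suc b 4))))))) sum≡)))
      where
      shuffle : ∀ b → suc (2 * suc b) ≡ b + 3 + b
      shuffle = solve-∀

  split-bound : ∀ {s a d x y l} → s ≤ a + d → a + 1 ≤ x → d + 1 ≤ y → x + y ≡ l → s + 2 ≤ l
  split-bound {s} {a} {d} s≤ a≤ d≤ refl = ≤-trans (+-monoˡ-≤ 2 s≤)
    (≤-trans (≤-reflexive (shuffle₄ a d 1 1)) (+-mono-≤ a≤ d≤))

  part-sizes : ∀ {x y l} → x + y ≡ l → l ≤ 4 → 2 ≤ x → 1 ≤ y → (x ≡ 2 ⊎ x ≡ 3) × (y ≡ 1 ⊎ y ≡ 2)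
  part-sizes {2} {1} _ _ _ _ = inj₁ refl , inj₁ refl
  part-sizes {2} {2} _ _ _ _ = inj₁ refl , inj₂ refl
  part-sizes {3} {1} _ _ _ _ = inj₂ refl , inj₁ refl
  part-sizes {1} _ _ (s≤s ()) _
  part-sizes {2} {suc (suc (suc _))} refl (s≤s (s≤s (s≤s (s≤s ()))))
  part-sizes {3} {suc (suc _)} refl (s≤s (s≤s (s≤s (s≤s ()))))
  part-sizes {suc (suc (suc (suc x)))} {suc y} refl (s≤s (s≤s (s≤s (s≤s p)))) with () ← subst (_≤ 0) (+-suc x y) p

module _ {n : ℕ} where

  private
    Graph : Set
    Graph = List (Edge n)

  record Position (C B : Graph) : Set where
    field
      noP  : ¬ Path₅ C
      ordC : Ordered C
      ordB : Ordered B
      disj : ∀ {x y} → Adj C x y → Adj B x y → ⊥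
  open Position

  -- Satisfied after each move of Blocker.  For a component S of C it bounds the number of edges of C
  -- inside S by 2 if |S| = 3 and by 4 if |S| = 4, since size C S + size B S ≤ choose₂ |S|.
  Balanced : Graph → Graph → Set
  Balanced C B = ∀ S → Unique S → 3 ≤ length S → length S ≤ 4 → Closed C S → size C S + 2 ≤ size B S + length S

  Balanced-∷ : ∀ {C B e} → Balanced C B → Balanced C (e ∷ B)
  Balanced-∷ {B = B} bal S u 3≤ ≤4 closed =
    ≤-trans (bal S u 3≤ ≤4 closed) (+-monoˡ-≤ (length S) (size-mono {G = B} S λ _ _ → Adj-∷))

  disjoint-∷ : ∀ {G H : Graph} {u v} → ¬ Adj H u v → (∀ {x y} → Adj G x y → Adj H x y → ⊥) →
    ∀ {x y} → Adj ((u , v) ∷ G) x y → Adj H x y → ⊥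
  disjoint-∷ {G} {H} ¬uv dis xyG xyH with Adj-∷⁻ {G = G} xyG
  ... | inj₁ old = dis old xyH
  ... | inj₂ (inj₁ (refl , refl)) = ¬uv xyH
  ... | inj₂ (inj₂ (refl , refl)) = ¬uv (Adj-sym {G = H} xyH)

  Position-C : ∀ {C B u v} → Position C B → (u , v) ∈ unclaimed C B → ¬ Path₅ ((u , v) ∷ C) → Position ((u , v) ∷ C) B
  Position-C {C} {B} pos e∈ noP′ = record
    { noP = noP′
    ; ordC = Ordered-∷ (∈-allEdges⁻ (proj₁ (∈-unclaimed⁻ {C = C} {B} e∈))) (ordC pos)
    ; ordB = ordB pos
    ; disj = disjoint-∷ {C} {B} (∉B (unclaimed⇒Free (ordC pos) (ordB pos) e∈)) (disj pos) }

  Position-B : ∀ {C B u v} → Position C B → (u , v) ∈ unclaimed C B → Position C ((u , v) ∷ B)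
  Position-B {C} {B} pos e∈ = record
    { noP = noP pos
    ; ordC = ordC pos
    ; ordB = Ordered-∷ (∈-allEdges⁻ (proj₁ (∈-unclaimed⁻ {C = C} {B} e∈))) (ordB pos)
    ; disj = λ xyC xyB → disjoint-∷ {B} {C} (∉C (unclaimed⇒Free (ordC pos) (ordB pos) e∈)) (λ b c → disj pos c b) xyB xyC }

  Position⇒size≤ : ∀ {C B} → Position C B → ∀ S → size C S + size B S ≤ choose₂ (length S)
  Position⇒size≤ {C} {B} pos S = size-disjoint {C = C} {B} S (disj pos)

  -- The moment between two moves: the position already contains uv, while the balance is known only
  -- for the graph without it.
  module Reply {C B : Graph} {u v : Fin n} (pos : Position ((u , v) ∷ C) B) (u≢v : u ≢ v) (bal : Balanced C B) where

    private
      C′ : Graph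
      C′ = (u , v) ∷ C

    Closed-old : ∀ {S} → Closed C′ S → Closed C S
    Closed-old closed = closed ∘ Adj-∷

    almost-balanced : ∀ S → Unique S → 3 ≤ length S → length S ≤ 4 → Closed C′ S →
      size C′ S + 2 ≤ suc (size B S + length S)
    almost-balanced S uniq 3≤ ≤4 closed =
      ≤-trans (+-monoˡ-≤ 2 (size-∷ uniq)) (s≤s (bal S uniq 3≤ ≤4 (Closed-old closed)))

    Tight : List (Fin n) → Set
    Tight S = ¬ (size C′ S + 2 ≤ size B S + length S)

    tight⇒inside : ∀ S → Unique S → 3 ≤ length S → length S ≤ 4 → Closed C′ S → Tight S → u ∈ S × v ∈ S
    tight⇒inside S uniq 3≤ ≤4 closed tight = decidable-stable ((u ∈? S) ×-dec (v ∈? S)) λ outside →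
      tight (≤-trans (+-monoˡ-≤ 2 (size-∷-outside {G = C} outside)) (bal S uniq 3≤ ≤4 (Closed-old closed)))

    few-vertices : ∀ S → (length S ≡ 1 ⊎ length S ≡ 2) → size C′ S + 1 ≤ length S
    few-vertices S eq = ≤-trans (+-monoˡ-≤ 1 (≤-trans (m≤m+n (size C′ S) (size B S)) (Position⇒size≤ pos S))) (arith eq)
      where
      arith : ∀ {l} → l ≡ 1 ⊎ l ≡ 2 → choose₂ l + 1 ≤ l
      arith (inj₁ refl) = ≤-refl
      arith (inj₂ refl) = ≤-refl

    closed-sparse : ∀ S → Unique S → (length S ≡ 2 ⊎ length S ≡ 3) → Closed C′ S → size C′ S + 1 ≤ length S
    closed-sparse S _ (inj₁ two) _ = few-vertices S (inj₂ two)
    closed-sparse S uniq (inj₂ three) closed = subst (size C′ S + 1 ≤_) (sym three) (small-bound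
      (subst (λ l → size C′ S + 2 ≤ suc (size B S + l)) three
        (almost-balanced S uniq (≤-reflexive (sym three)) (≤-trans (≤-reflexive three) (n≤1+n 3)) closed))
      (≤-trans (Position⇒size≤ pos S) (≤-reflexive (cong choose₂ three))))

    -- A tight set is connected, hence contained in every closed set that meets it.
    tight⊆closed : ∀ S R → Unique S → length S ≤ 4 → Closed C′ S → Tight S → u ∈ S × v ∈ S →
      Closed C′ R → u ∈ R × v ∈ R → S ⊆ R
    tight⊆closed S R uniq ≤4 closedS tight (u∈S , v∈S) closedR (u∈R , v∈R) {p} p∈S =
      -- If p is outside R, then S splits into A inside R, of size 2 or 3, and D outside R, of size
      -- 1 or 2. Parts this small span at most |A| - 1 and |D| - 1 edges of Constructor, so S spans
      -- at most |S| - 2 and is not tight.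
      decidable-stable (p ∈? R) λ p∉R →
        let lengths = length-filter-split (_∈? R) S
            |A|≥2 = Unique∧⊆⇒length≤ {ys = A} ((u≢v ∷ []) ∷ [] ∷ []) λ
              { (here refl) → ∈-filter⁺ (_∈? R) u∈S u∈R
              ; (there (here refl)) → ∈-filter⁺ (_∈? R) v∈S v∈R }
            |D|≥1 = Unique∧⊆⇒length≤ {ys = D} ([] ∷ []) λ { (here refl) → ∈-filter⁺ (_∉? R) p∈S p∉R }
            |A| , |D| = part-sizes lengths ≤4 |A|≥2 |D|≥1
        in tight (≤-trans
             (split-bound (size-split {G = C′} S closedR)
               (closed-sparse A (Unique.filter⁺ (_∈? R) uniq) |A| closedA) (few-vertices D |D|) lengths)
             (m≤n+m (length S) (size B S)))
      where
      A D : List (Fin n)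
      A = filter (_∈? R) S
      D = filter (_∉? R) S
      closedA : Closed C′ A
      closedA xy x∈ with ∈-filter⁻ (_∈? R) {xs = S} x∈
      ... | x∈S , x∈R = ∈-filter⁺ (_∈? R) (closedS xy x∈S) (closedR xy x∈R)

    -- Any free pair of S serves as reply. Every tight R contains u and v, hence all of S and with
    -- it the claimed pair, and this makes up its deficit of one. A tight S cannot be full, by the
    -- parity in `full-balanced`.
    block : ∀ S → Unique S → 3 ≤ length S → length S ≤ 4 → Closed C′ S → Tight S →
      ∃ λ e → e ∈ unclaimed C′ B × Balanced C′ (e ∷ B)
    block S uniq 3≤ ≤4 closed tight with size-cover C′ B S uniq
    ... | inj₂ full = contradiction
      (full-balanced 3≤ ≤4 (Position⇒size≤ pos S) full (almost-balanced S uniq 3≤ ≤4 closed)) tight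
    ... | inj₁ (p , q , p∈ , q∈ , free) = edge p q , Free⇒unclaimed free , balanced
      where
      balanced : Balanced C′ (edge p q ∷ B)
      balanced R uniqR 3≤R R≤4 closedR with size C′ R + 2 ≤? size B R + length R
      ... | yes ok = ≤-trans ok (+-monoˡ-≤ (length R) (size-mono {G = B} R λ _ _ → Adj-∷))
      ... | no tightR = ≤-trans (almost-balanced R uniqR 3≤R R≤4 closedR)
        (+-monoˡ-≤ (length R) (size-edge {G = B} (≢-ends free) (S⊆R p∈) (S⊆R q∈) (∉B free)))
        where
        S⊆R : S ⊆ R
        S⊆R = tight⊆closed S R uniq ≤4 closed tight (tight⇒inside S uniq 3≤ ≤4 closed tight)
          closedR (tight⇒inside R uniqR 3≤R R≤4 closedR tightR)

-- Triangles in the final position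

abstract

  diamond-arith : ∀ {s b} → 5 ≤ s → s + 2 ≤ b + 4 → s + b ≤ 6 → ⊥
  diamond-arith {s} {zero} 5≤s p _ = <⇒≱ (s≤s (s≤s (s≤s (s≤s (s≤s z≤n))))) (≤-trans (+-monoˡ-≤ 2 5≤s) p)
  diamond-arith {s} {suc zero} 5≤s p _ = <⇒≱ (s≤s (s≤s (s≤s (s≤s (s≤s (s≤s z≤n)))))) (≤-trans (+-monoˡ-≤ 2 5≤s) p)
  diamond-arith {s} {suc (suc b)} 5≤s _ q = <⇒≱ (s≤s (m≤m+n 6 b)) (≤-trans (+-monoˡ-≤ (suc (suc b)) 5≤s) q)

  triangle-arith : ∀ {s b} → 3 ≤ s → s + 2 ≤ b + 3 → s + b ≤ 3 → ⊥
  triangle-arith {s} {zero} 3≤s p _ = <⇒≱ (s≤s (s≤s (s≤s (s≤s z≤n)))) (≤-trans (+-monoˡ-≤ 2 3≤s) p)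
  triangle-arith {s} {suc b} 3≤s _ q = <⇒≱ (m≤m+n 4 b) (≤-trans (≤-trans (≤-reflexive (sym (+-suc 3 b))) (+-monoˡ-≤ (suc b) 3≤s)) q)

  -- The middle entry is settled first: j lies strictly between i and k, both in the second triple,
  -- so it is neither the least nor the greatest element there. The outer entries follow.
  sorted-⊆ : ∀ {i j k i′ j′ k′} → i < j → j < k → i′ < j′ → j′ < k′ →
    (i ∷ j ∷ k ∷ []) ⊆ (i′ ∷ j′ ∷ k′ ∷ []) → i ≡ i′ × j ≡ j′ × k ≡ k′
  sorted-⊆ {i} {j} {k} {i′} {j′} {k′} i<j j<k i<j′ j<k′ sub = i≡ (sub (here refl)) , j≡j′ , k≡ (sub (there (there (here refl))))
    where
    above : ∀ {x} → x ∈ i′ ∷ j′ ∷ k′ ∷ [] → i′ ≤ x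
    above (here refl) = ≤-refl
    above (there (here refl)) = <⇒≤ i<j′
    above (there (there (here refl))) = <⇒≤ (<-trans i<j′ j<k′)
    below : ∀ {x} → x ∈ i′ ∷ j′ ∷ k′ ∷ [] → x ≤ k′
    below (here refl) = <⇒≤ (<-trans i<j′ j<k′)
    below (there (here refl)) = <⇒≤ j<k′
    below (there (there (here refl))) = ≤-refl
    mid : j ∈ i′ ∷ j′ ∷ k′ ∷ [] → j ≡ j′
    mid (here refl) = contradiction (above (sub (here refl))) (<⇒≱ i<j)
    mid (there (here eq)) = eq
    mid (there (there (here refl))) = contradiction (below (sub (there (there (here refl))))) (<⇒≱ j<k)
    j≡j′ : j ≡ j′
    j≡j′ = mid (sub (there (here refl)))
    i≡ : i ∈ i′ ∷ j′ ∷ k′ ∷ [] → i ≡ i′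
    i≡ (here eq) = eq
    i≡ (there (here eq)) = contradiction (trans eq (sym j≡j′)) (<⇒≢ i<j)
    i≡ (there (there (here refl))) = contradiction i<j (<-asym (subst (_< k′) (sym j≡j′) j<k′))
    k≡ : k ∈ i′ ∷ j′ ∷ k′ ∷ [] → k ≡ k′
    k≡ (here refl) = contradiction j<k (<-asym (subst (i′ <_) (sym j≡j′) i<j′))
    k≡ (there (here eq)) = contradiction (trans j≡j′ (sym eq)) (<⇒≢ j<k)
    k≡ (there (there (here eq))) = eq

count-all : {A : Set} {p : A → Bool} {xs : List A} → All (T ∘ p) xs → count p xs ≡ length xs
count-all {p = p} all = cong length (filter-all (T? ∘ p) all)

module EndPosition {n : ℕ} {C B : List (Edge n)} (pos : Position C B) (bal : Balanced C B) where

  open Position pos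

  private
    symm : ∀ {x y} → Adj C x y → Adj C y x
    symm = Adj-sym {G = C}

    Adj⇒≢ : ∀ {x y} → Adj C x y → x ≢ y
    Adj⇒≢ = Ordered⇒≢ ordC

    Adj⇒≢′ : ∀ {x y} → Adj C x y → y ≢ x
    Adj⇒≢′ = ≢-sym ∘ Adj⇒≢

  swap₁₂ : ∀ {a b c} → Triangle C a b c → Triangle C b a c
  swap₁₂ = Triangle-swap₁₂ {G = C}

  swap₂₃ : ∀ {a b c} → Triangle C a b c → Triangle C a c b
  swap₂₃ = Triangle-swap₂₃ {G = C}

  -- An edge leaving the diamond would complete a `Path₅`, so its four vertices form a closed set.
  -- With five edges of Constructor inside, balance asks for three edges of Blocker among only six
  -- pairs.
  no-diamond : ∀ {a b c e} → Triangle C a b c → Adj C a e → Adj C b e → e ≢ c → ⊥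
  no-diamond {a} {b} {c} {e} (ab , bc , ac) ae be e≢c = diamond-arith five
    (bal S uniq (s≤s (s≤s (s≤s z≤n))) ≤-refl closed) (Position⇒size≤ pos S)
    where
    S : List (Fin n)
    S = a ∷ b ∷ c ∷ e ∷ []
    c≢e = ≢-sym e≢c
    uniq : Unique S
    uniq = (Adj⇒≢ ab ∷ Adj⇒≢ ac ∷ Adj⇒≢ ae ∷ []) ∷ (Adj⇒≢ bc ∷ Adj⇒≢ be ∷ []) ∷ (c≢e ∷ []) ∷ [] ∷ []
    five : 5 ≤ size C S
    five = +-mono-≤
      (≤-reflexive (sym (count-all {p = adj C a} {b ∷ c ∷ e ∷ []} (adj⁺ {u = a} ab ∷ adj⁺ {u = a} ac ∷ adj⁺ {u = a} ae ∷ []))))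
      (≤-trans (≤-reflexive (sym (count-all {p = adj C b} {c ∷ e ∷ []} (adj⁺ {u = b} bc ∷ adj⁺ {u = b} be ∷ [])))) (m≤m+n _ _))
    ∉⇒≢ : ∀ {x y} → y ∉ S → x ∈ S → y ≢ x
    ∉⇒≢ y∉ x∈ refl = y∉ x∈
    -- Each vertex of a diamond is an end of a Hamiltonian path of it.
    closed : Closed C S
    closed {x} {y} xy x∈ = decidable-stable (y ∈? S) λ y∉ →
      let y≢a = ∉⇒≢ y∉ (here refl)
          y≢b = ∉⇒≢ y∉ (there (here refl))
          y≢c = ∉⇒≢ y∉ (there (there (here refl)))
          y≢e = ∉⇒≢ y∉ (there (there (there (here refl))))
      in case x∈ of λ
        { (here refl) → noP (path ((y≢a ∷ y≢c ∷ y≢b ∷ y≢e ∷ []) ∷ (Adj⇒≢ ac ∷ Adj⇒≢ ab ∷ Adj⇒≢ ae ∷ [])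
            ∷ (Adj⇒≢′ bc ∷ c≢e ∷ []) ∷ (Adj⇒≢ be ∷ []) ∷ [] ∷ []) (symm xy) ac (symm bc) be)
        ; (there (here refl)) → noP (path ((y≢b ∷ y≢c ∷ y≢a ∷ y≢e ∷ []) ∷ (Adj⇒≢ bc ∷ Adj⇒≢′ ab ∷ Adj⇒≢ be ∷ [])
            ∷ (Adj⇒≢′ ac ∷ c≢e ∷ []) ∷ (Adj⇒≢ ae ∷ []) ∷ [] ∷ []) (symm xy) bc (symm ac) ae)
        ; (there (there (here refl))) → noP (path ((y≢c ∷ y≢a ∷ y≢e ∷ y≢b ∷ []) ∷ (Adj⇒≢′ ac ∷ c≢e ∷ Adj⇒≢′ bc ∷ [])
            ∷ (Adj⇒≢ ae ∷ Adj⇒≢ ab ∷ []) ∷ (Adj⇒≢′ be ∷ []) ∷ [] ∷ []) (symm xy) (symm ac) ae (symm be))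
        ; (there (there (there (here refl)))) → noP (path ((y≢e ∷ y≢a ∷ y≢c ∷ y≢b ∷ []) ∷ (Adj⇒≢′ ae ∷ e≢c ∷ Adj⇒≢′ be ∷ [])
            ∷ (Adj⇒≢ ac ∷ Adj⇒≢ ab ∷ []) ∷ (Adj⇒≢′ bc ∷ []) ∷ [] ∷ []) (symm xy) (symm ae) ac (symm bc))
        }

  -- Two different triangles through a either share an edge, which gives a diamond, or meet only in
  -- a, and then b, c, a, d, e is a path on five vertices.
  common-vertex : ∀ {a b c d e} → Triangle C a b c → Triangle C a d e → (d ≡ b × e ≡ c) ⊎ (d ≡ c × e ≡ b)
  common-vertex {a} {b} {c} {d} {e} t@(ab , bc , ac) (ad , de , ae) with d ≟ᶠ b | e ≟ᶠ c
  ... | yes d≡b  | yes e≡c  = inj₁ (d≡b , e≡c)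
  ... | yes refl | no e≢c   = ⊥-elim (no-diamond t ae de e≢c)
  ... | no d≢b   | yes refl = ⊥-elim (no-diamond (swap₂₃ t) ad (symm de) d≢b)
  ... | no d≢b   | no e≢c with d ≟ᶠ c | e ≟ᶠ b
  ...   | yes d≡c  | yes e≡b  = inj₂ (d≡c , e≡b)
  ...   | yes refl | no e≢b   = ⊥-elim (no-diamond (swap₂₃ t) ae de e≢b)
  ...   | no d≢c   | yes refl = ⊥-elim (no-diamond t ad (symm de) d≢c)
  ...   | no d≢c   | no e≢b   = ⊥-elim (noP (path
          ((Adj⇒≢ bc ∷ Adj⇒≢′ ab ∷ ≢-sym d≢b ∷ ≢-sym e≢b ∷ []) ∷ (Adj⇒≢′ ac ∷ ≢-sym d≢c ∷ ≢-sym e≢c ∷ [])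
            ∷ (Adj⇒≢ ad ∷ Adj⇒≢ ae ∷ []) ∷ (Adj⇒≢ de ∷ []) ∷ [] ∷ [])
          bc (symm ac) ad de))

  vertices : Triple → List (Fin n)
  vertices (i , j , k) = i ∷ j ∷ k ∷ []

  IsTriangle : Triple → Set
  IsTriangle t = T (isTriangle C t)

  -- Puts an arbitrary vertex of a sorted triple first, so that arguments about one vertex need no
  -- case distinction on its place.
  record Apex (t : Triple) (x : Fin n) : Set where
    constructor apex
    field
      {y z} : Fin n
      xyz   : Triangle C x y z
      y∈    : y ∈ vertices t
      z∈    : z ∈ vertices t
      cover : vertices t ⊆ x ∷ y ∷ z ∷ []

  toApex : ∀ {t x} → IsTriangle t → x ∈ vertices t → Apex t x
  toApex {i , j , k} tri x∈ with isTriangle⁻ {G = C} i j k tri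
  toApex tri (here refl) | _ , _ , t = apex t (there (here refl)) (there (there (here refl))) id
  toApex tri (there (here refl)) | _ , _ , t = apex (swap₁₂ t) (here refl) (there (there (here refl))) λ
    { (here e) → there (here e) ; (there (here e)) → here e ; (there (there p)) → there (there p) }
  toApex tri (there (there (here refl))) | _ , _ , t = apex (swap₁₂ (swap₂₃ t)) (here refl) (there (here refl)) λ
    { (here e) → there (here e) ; (there (here e)) → there (there (here e)) ; (there (there (here e))) → here e }

  -- A shared vertex forces equal vertex sets by `common-vertex`, and sorted triples on the same
  -- vertices coincide.
  triangles-disjoint : ∀ {t t′} → IsTriangle t → IsTriangle t′ → t ≢ t′ → Disjoint (vertices t) (vertices t′)
  triangles-disjoint {t@(i , j , k)} {t′@(i′ , j′ , k′)} tri tri′ t≢t′ {v} (v∈ , v∈′)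
    with toApex {t} tri v∈ | toApex {t′} tri′ v∈′
  ... | apex {y} {z} t₁ _ _ cover | apex {y′} {z′} t₂ y∈′ z∈′ _ =
    t≢t′ (equal (isTriangle⁻ {G = C} i j k tri) (isTriangle⁻ {G = C} i′ j′ k′ tri′) (sub ∘ cover))
    where
    sub : v ∷ y ∷ z ∷ [] ⊆ vertices t′
    sub (here refl) = v∈′
    sub (there (here refl)) = [ (λ (y′≡y , _) → subst (_∈ vertices t′) y′≡y y∈′)
                              , (λ (_ , z′≡y) → subst (_∈ vertices t′) z′≡y z∈′) ]′ (common-vertex t₁ t₂)
    sub (there (there (here refl))) = [ (λ (_ , z′≡z) → subst (_∈ vertices t′) z′≡z z∈′)
                                      , (λ (y′≡z , _) → subst (_∈ vertices t′) y′≡z y∈′) ]′ (common-vertex t₁ t₂)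
    equal : toℕ i < toℕ j × toℕ j < toℕ k × Triangle C i j k → toℕ i′ < toℕ j′ × toℕ j′ < toℕ k′ × Triangle C i′ j′ k′ →
      vertices t ⊆ vertices t′ → t ≡ t′
    equal (i<j , j<k , _) (i<j′ , j<k′ , _) ⊆′
      with sorted-⊆ i<j j<k i<j′ j<k′ (⊆-map toℕ ⊆′)
    ... | i≡ , j≡ , k≡ = cong₂ _,_ (toℕ-injective i≡) (cong₂ _,_ (toℕ-injective j≡) (toℕ-injective k≡))

  IsPendant : Triple → Fin n → Set
  IsPendant t z = z ∉ vertices t × Any (λ x → Adj C x z) (vertices t)

  isPendant? : ∀ t z → Dec (IsPendant t z)
  isPendant? t z = (z ∉? vertices t) ×-dec Any.any? (λ x → Adj? C x z) (vertices t)

  -- The value i is junk: a triangle always has a pendant vertex.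
  pendant : Triple → Fin n
  pendant t@(i , _ , _) with any? (isPendant? t)
  ... | yes (z , _) = z
  ... | no _        = i

  -- A triangle without a neighbour outside would be closed, and balance would then demand two edges
  -- of Blocker where no pair is left.
  pendant-spec : ∀ t → IsTriangle t → IsPendant t (pendant t)
  pendant-spec t@(i , j , k) tri with any? (isPendant? t)
  ... | yes (_ , p) = p
  ... | no none with isTriangle⁻ {G = C} i j k tri
  ...   | i<j , j<k , ij , jk , ik = ⊥-elim (triangle-arith three
          (bal (vertices t) ((Adj⇒≢ ij ∷ Adj⇒≢ ik ∷ []) ∷ (Adj⇒≢ jk ∷ []) ∷ [] ∷ []) ≤-refl (n≤1+n 3) closed)
          (Position⇒size≤ pos (vertices t)))
    where
    three : 3 ≤ size C (vertices t)
    three = +-mono-≤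
      (≤-reflexive (sym (count-all {p = adj C i} {j ∷ k ∷ []} (adj⁺ {u = i} ij ∷ adj⁺ {u = i} ik ∷ []))))
      (≤-trans (≤-reflexive (sym (count-all {p = adj C j} {k ∷ []} (adj⁺ {u = j} jk ∷ [])))) (m≤m+n _ _))
    closed : Closed C (vertices t)
    closed {x} {y} xy x∈ = decidable-stable (y ∈? vertices t) λ y∉ → none (y , y∉ , lose x∈ xy)

  quad : Triple → List (Fin n)
  quad t = pendant t ∷ vertices t

  quad-Unique : ∀ {t} → IsTriangle t → Unique (quad t)
  quad-Unique {t@(i , j , k)} tri with isTriangle⁻ {G = C} i j k tri
  ... | _ , _ , ij , jk , ik =
    All.tabulate (λ { x∈ refl → proj₁ (pendant-spec t tri) x∈ })
      ∷ (Adj⇒≢ ij ∷ Adj⇒≢ ik ∷ []) ∷ (Adj⇒≢ jk ∷ []) ∷ [] ∷ []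

  -- Otherwise a path goes around t to x, on to the pendant vertex, and one step further inside t′:
  -- five vertices.
  pendant∉ : ∀ {t t′} → IsTriangle t → IsTriangle t′ → Disjoint (vertices t) (vertices t′) → pendant t ∉ vertices t′
  pendant∉ {t} {t′} tri tri′ dis p∈ with find (proj₂ (pendant-spec t tri))
  ... | x , x∈ , xp with toApex {t} tri x∈ | toApex {t′} tri′ p∈
  ... | apex {y} {z} (xy , yz , xz) y∈ z∈ _ | apex {p′} (pp′ , _ , _) p∈′ _ _ = noP (path
      ((Adj⇒≢ yz ∷ Adj⇒≢′ xy ∷ apart y∈ p∈ ∷ apart y∈ p∈′ ∷ []) ∷ (Adj⇒≢′ xz ∷ apart z∈ p∈ ∷ apart z∈ p∈′ ∷ [])
        ∷ (Adj⇒≢ xp ∷ apart x∈ p∈′ ∷ []) ∷ (Adj⇒≢ pp′ ∷ []) ∷ [] ∷ [])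
      yz (symm xz) xp pp′)
    where
    apart : ∀ {a b} → a ∈ vertices t → b ∈ vertices t′ → a ≢ b
    apart a∈ b∈ refl = dis (a∈ , b∈)

  -- A common pendant vertex would extend the path y, z, x through t to a fifth vertex, its
  -- neighbour in t′.
  pendant-≢ : ∀ {t t′} → IsTriangle t → IsTriangle t′ → Disjoint (vertices t) (vertices t′) → pendant t ≢ pendant t′
  pendant-≢ {t} {t′} tri tri′ dis p≡ with find (proj₂ (pendant-spec t tri)) | find (proj₂ (pendant-spec t′ tri′))
  ... | x , x∈ , xp | x′ , x∈′ , xp′ with toApex {t} tri x∈
  ... | apex {y} {z} (xy , yz , xz) y∈ z∈ _ = noP (path
      ((Adj⇒≢ yz ∷ Adj⇒≢′ xy ∷ off y∈ ∷ apart y∈ x∈′ ∷ []) ∷ (Adj⇒≢′ xz ∷ off z∈ ∷ apart z∈ x∈′ ∷ [])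
        ∷ (Adj⇒≢ xp ∷ apart x∈ x∈′ ∷ []) ∷ (Adj⇒≢′ x′p ∷ []) ∷ [] ∷ [])
      yz (symm xz) xp (symm x′p))
    where
    x′p : Adj C x′ (pendant t)
    x′p = subst (Adj C x′) (sym p≡) xp′
    apart : ∀ {a b} → a ∈ vertices t → b ∈ vertices t′ → a ≢ b
    apart a∈ b∈ refl = dis (a∈ , b∈)
    off : ∀ {a} → a ∈ vertices t → a ≢ pendant t
    off a∈ refl = proj₁ (pendant-spec t tri) a∈

  quads-disjoint : ∀ {t t′} → IsTriangle t → IsTriangle t′ → t ≢ t′ → Disjoint (quad t) (quad t′)
  quads-disjoint {t} {t′} tri tri′ t≢t′ = λ
    { (here refl , here p≡) → pendant-≢ {t} {t′} tri tri′ dis p≡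
    ; (here refl , there p∈) → pendant∉ {t} {t′} tri tri′ dis p∈
    ; (there p∈ , here refl) → pendant∉ {t′} {t} tri′ tri (λ (a , b) → dis (b , a)) p∈
    ; (there a , there b) → dis (a , b) }
    where
    dis : Disjoint (vertices t) (vertices t′)
    dis = triangles-disjoint {t} {t′} tri tri′ t≢t′

  all-quads-disjoint : ∀ {ts} → Unique ts → All IsTriangle ts → AllPairs Disjoint (map quad ts)
  all-quads-disjoint [] [] = []
  all-quads-disjoint {t ∷ ts} (t∉ ∷ u) (tri ∷ tris) =
    All.map⁺ (All.tabulate λ {t′} t∈ → quads-disjoint {t} {t′} tri (All.lookup tris t∈) (All.lookup t∉ t∈))
      ∷ all-quads-disjoint u tris

  length-quads : ∀ ts → length (concat (map quad ts)) ≡ length ts * 4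
  length-quads [] = refl
  length-quads (t ∷ ts) = cong (4 +_) (length-quads ts)

  4*triangles≤n : 4 * triangles C ≤ n
  4*triangles≤n = begin
    4 * triangles C            ≡⟨ cong (4 *_) (triangles≡count C) ⟩
    4 * length ts              ≡⟨ *-comm 4 (length ts) ⟩
    length ts * 4              ≡⟨ length-quads ts ⟨
    length (concat (map quad ts)) ≤⟨ Unique⇒length≤ (Unique.concat⁺
      (All.map⁺ (All.map (λ {t} → quad-Unique {t}) tris))
      (all-quads-disjoint (Unique.filter⁺ (T? ∘ isTriangle C) triples-Unique) tris)) ⟩
    n                          ∎
    where
    open ≤-Reasoning
    ts : List (Triple {n})
    ts = filterᵇ (isTriangle C) triples
    tris : All IsTriangle ts
    tris = All.all-filter (T? ∘ isTriangle C) triples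

-- The value of the game

module _ {n : ℕ} where

  -- The fuel has to cover all unclaimed edges, because right after Constructor's move the balance
  -- may be broken and the recursion must still reach the reply that restores it.
  blocker-bound : ∀ f {C B : List (Edge n)} {u v} → Position C B → Balanced C B → (u , v) ∈ legalC C B →
    length (unclaimed ((u , v) ∷ C) B) ≤ f → 4 * valB f ((u , v) ∷ C) B ≤ n
  constructor-bound : ∀ f {C B : List (Edge n)} → Position C B → Balanced C B →
    length (unclaimed C B) ≤ f → 4 * valC f C B ≤ n

  constructor-bound zero pos bal _ = EndPosition.4*triangles≤n pos bal
  constructor-bound (suc f) {C} {B} pos bal fuel =
    valC-elim (λ t → 4 * t ≤ n) f C B (EndPosition.4*triangles≤n pos bal) λ {e} e∈ →
      blocker-bound f pos bal e∈ (≤-pred (<-≤-trans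
        (unclaimed-shrinks C B (e ∷ C) B (proj₁ (∈-legalC⁻ {C = C} {B} e∈)) there id (inj₁ (here refl))) fuel))

  -- If the bound failed, no reply of Blocker could restore the balance, so no closed set would be
  -- tight and every reply would keep the balance.
  blocker-bound f {C} {B} {u} {v} pos bal e∈ fuel =
    decidable-stable (4 * valB f C′ B ≤? n) λ unbounded → unbounded (any-reply f fuel λ S uniq 3≤ ≤4 closed →
      decidable-stable (size C′ S + 2 ≤? size B S + length S) λ tight →
        unbounded (good-reply f fuel (Reply.block pos′ (≢-ends free) bal S uniq 3≤ ≤4 closed tight)))
    where
    C′ = (u , v) ∷ C
    e∈unclaimed : (u , v) ∈ unclaimed C B
    e∈unclaimed = proj₁ (∈-legalC⁻ {C = C} {B} e∈)
    free : Free C B u v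
    free = unclaimed⇒Free (Position.ordC pos) (Position.ordB pos) e∈unclaimed
    pos′ : Position C′ B
    pos′ = Position-C pos e∈unclaimed (proj₂ (∈-legalC⁻ {C = C} {B} e∈))
    shrinks : ∀ {f b} → b ∈ unclaimed C′ B → length (unclaimed C′ B) ≤ suc f → length (unclaimed C′ (b ∷ B)) ≤ f
    shrinks {b = b} b∈ fuel = ≤-pred (<-≤-trans (unclaimed-shrinks C′ B C′ (b ∷ B) b∈ id there (inj₂ (here refl))) fuel)
    good-reply : ∀ f → length (unclaimed C′ B) ≤ f → (∃ λ b → b ∈ unclaimed C′ B × Balanced C′ (b ∷ B)) →
      4 * valB f C′ B ≤ n
    good-reply zero fuel (b , b∈ , _) with () ← <-≤-trans (∈-length b∈) fuel
    good-reply (suc f) fuel (b , b∈ , bal′) = ≤-trans (*-monoʳ-≤ 4 (valB-≤ f C′ B b∈ ≤-refl))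
      (constructor-bound f (Position-B pos′ b∈) bal′ (shrinks b∈ fuel))
    any-reply : ∀ f → length (unclaimed C′ B) ≤ f → Balanced C′ B → 4 * valB f C′ B ≤ n
    any-reply zero _ bal′ = EndPosition.4*triangles≤n pos′ bal′
    any-reply (suc f) fuel bal′ = valB-elim (λ t → 4 * t ≤ n) f C′ B (EndPosition.4*triangles≤n pos′ bal′) λ {b} b∈ →
      constructor-bound f (Position-B pos′ b∈) (Balanced-∷ {C = C′} {B} bal′) (shrinks b∈ fuel)

  size-[] : (S : List (Fin n)) → size [] S ≡ 0
  size-[] [] = refl
  size-[] (x ∷ S) = cong₂ _+_ (count-none S λ {y} _ t → case adj⁻ {G = []} {u = x} {y} t of λ { (inj₁ ()) ; (inj₂ ()) }) (size-[] S)

4*g≤n : ∀ n → 4 * g n ≤ n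
4*g≤n n = constructor-bound {n} (length (allEdges n))
  record { noP = λ { (path _ (inj₁ ()) _ _ _) ; (path _ (inj₂ ()) _ _ _) }
         ; ordC = λ () ; ordB = λ () ; disj = λ { (inj₁ ()) ; (inj₂ ()) } }
  -- On the empty board both counts vanish and the inequality reads 2 ≤ |S|.
  (λ S _ 3≤ _ _ → subst (λ s → s + 2 ≤ size [] S + length S) (sym (size-[] S))
    (≤-trans (<⇒≤ 3≤) (m≤n+m (length S) (size [] S))))
  (length-filter _ (allEdges n))

-- Asymptotics: the degree threshold and the number of blocks

module _ (k n : ℕ) where

  private
    -- K is both the degree threshold and the inverse of the permitted error. Since 8t ≤ 2n < (2q +
    -- 2)K, at most h = 2q + 1 vertices have high degree. Of the 3q vertices withheld from the
    -- blocks, 2q pay for these, and the remaining q pays for the O(K) vertices forbidden at each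
    -- choice.
    K q r t : ℕ
    K = suc k
    q = n / K
    r = n ∸ 3 * q
    t = r / 4

    n≡ : n ≡ n % K + q * K
    n≡ = m≡m%n+[m/n]*n n K

    q*K≤n : q * K ≤ n
    q*K≤n = ≤-trans (m≤n+m (q * K) (n % K)) (≤-reflexive (sym n≡))

    n<suc[q]*K : n < suc q * K
    n<suc[q]*K = subst (_< suc q * K) (sym n≡) (+-monoˡ-< (q * K) (m%n<n n K))

    4*t≤r : 4 * t ≤ r
    4*t≤r = ≤-trans (≤-reflexive (*-comm 4 t)) (m/n*n≤m r 4)

    r≤ : r ≤ 3 + 4 * t
    r≤ = ≤-trans (≤-reflexive (m≡m%n+[m/n]*n r 4)) (+-mono-≤ (≤-pred (m%n<n r 4)) (≤-reflexive (*-comm t 4)))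

    abstract

      sparse : 2 * (4 * t) < suc (2 * q + 1) * K
      sparse = begin-strict
        2 * (4 * t)         ≤⟨ *-monoʳ-≤ 2 (≤-trans 4*t≤r (m∸n≤m n (3 * q))) ⟩
        2 * n               <⟨ *-monoʳ-< 2 n<suc[q]*K ⟩
        2 * (suc q * K)     ≡⟨ shuffle q K ⟩
        suc (2 * q + 1) * K ∎
        where
        open ≤-Reasoning
        shuffle : ∀ q K → 2 * (suc q * K) ≡ suc (2 * q + 1) * K
        shuffle = solve-∀

      room : 3 * K + 11 ≤ q → 3 * q ≤ n → 4 * t + (2 * q + 1) + (3 * K + 10) ≤ n
      room large 3q≤n = begin
        4 * t + (2 * q + 1) + (3 * K + 10) ≡⟨ shuffle (4 * t) q K ⟩
        4 * t + (3 * K + 11 + 2 * q)       ≤⟨ +-mono-≤ 4*t≤r (+-monoˡ-≤ (2 * q) large) ⟩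
        r + 3 * q                          ≡⟨ m∸n+n≡m 3q≤n ⟩
        n                                  ∎
        where
        open ≤-Reasoning
        shuffle : ∀ u q K → u + (2 * q + 1) + (3 * K + 10) ≡ u + (3 * K + 11 + 2 * q)
        shuffle = solve-∀

      3*K≤n : K * (3 * K + 11) ≤ n → 3 * K ≤ n
      3*K≤n n-large = ≤-trans (≤-reflexive (*-comm 3 K))
        (≤-trans (*-monoʳ-≤ K (≤-trans (m≤m+n 3 8) (m≤n+m 11 (3 * K)))) n-large)

      large-q : K * (3 * K + 11) ≤ n → 3 * K + 11 ≤ q
      large-q n-large = ≤-pred (*-cancelʳ-< K (3 * K + 11) (suc q)
        (≤-<-trans (≤-trans (≤-reflexive (*-comm (3 * K + 11) K)) n-large) n<suc[q]*K))

      -- The slack 4n splits into 3n for the 3q withheld vertices, as qK ≤ n, and n for rounding r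
      -- down to a multiple of 4, which costs at most 3K.
      enough : 3 * K ≤ n → 3 * q ≤ n → ∀ {s} → t ≤ s → K * n ≤ 4 * K * s + 4 * n
      enough 3K≤n 3q≤n {s} t≤s = begin
        K * n                                  ≡⟨ cong (K *_) (m∸n+n≡m 3q≤n) ⟨
        K * (r + 3 * q)                        ≤⟨ *-monoʳ-≤ K (+-monoˡ-≤ (3 * q) r≤) ⟩
        K * (3 + 4 * t + 3 * q)                ≡⟨ shuffle K t q ⟩
        4 * K * t + (3 * K + 3 * (q * K))      ≤⟨ +-mono-≤ (*-monoʳ-≤ (4 * K) t≤s) (+-mono-≤ 3K≤n (*-monoʳ-≤ 3 q*K≤n)) ⟩
        4 * K * s + 4 * n                      ∎
        where
        open ≤-Reasoning
        shuffle : ∀ K t q → K * (3 + 4 * t + 3 * q) ≡ 4 * K * t + (3 * K + 3 * (q * K))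
        shuffle = solve-∀

      trivial : n < 3 * q → ∀ s → K * n ≤ 4 * K * s + 4 * n
      trivial n<3q s = begin
        K * n               ≤⟨ *-monoʳ-≤ K (<⇒≤ n<3q) ⟩
        K * (3 * q)         ≡⟨ shuffle K q ⟩
        3 * (q * K)         ≤⟨ *-monoʳ-≤ 3 q*K≤n ⟩
        3 * n               ≤⟨ m≤n+m (3 * n) n ⟩
        4 * n               ≤⟨ m≤n+m (4 * n) (4 * K * s) ⟩
        4 * K * s + 4 * n   ∎
        where
        open ≤-Reasoning
        shuffle : ∀ K q → K * (3 * q) ≡ 3 * (q * K)
        shuffle = solve-∀

  lower-bound : suc k * (3 * suc k + 11) ≤ n → suc k * n ≤ 4 * suc k * g n + 4 * n
  lower-bound n-large with 3 * q ≤? n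
  ... | yes 3q≤n = enough (3*K≤n n-large) 3q≤n
    (Constructor.t≤g K (2 * q + 1) t sparse (room (large-q n-large) 3q≤n))
  -- Here qK ≤ n < 3q, so K < 3 and the error term 4n alone exceeds Kn.
  ... | no 3q≰n = trivial (≰⇒> 3q≰n) (g n)

  upper-bound : 4 * suc k * g n ≤ suc k * n + 4 * n
  upper-bound = begin
    4 * K * g n     ≡⟨ cong (_* g n) (*-comm 4 K) ⟩
    K * 4 * g n     ≡⟨ *-assoc K 4 (g n) ⟩
    K * (4 * g n)   ≤⟨ *-monoʳ-≤ K (4*g≤n n) ⟩
    K * n           ≤⟨ m≤m+n (K * n) (4 * n) ⟩
    K * n + 4 * n   ∎
    where open ≤-Reasoning

-- Divided by 4(k + 1)n, the two inequalities say that g(n)/n differs from 1/4 by at most 1/(k + 1).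
-- The threshold N makes n / (k + 1) at least 3(k + 1) + 11, as `room` requires.
theorem1p5 : (k : ℕ) → Σ ℕ (λ N → (n : ℕ) → N ≤ n →
    (4 * suc k * g n ≤ suc k * n + 4 * n) × (suc k * n ≤ 4 * suc k * g n + 4 * n))
theorem1p5 k = suc k * (3 * suc k + 11) , λ n N≤n → upper-bound k n , lower-bound k n N≤n
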